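{- Let $\mathcal{H}=\{rrr,rrb,yyr\}$. Then, as $n\to\infty$, $h_2(n,\mathcal{H})=\Omega(n^{2/3}\log^{1/3}n)$ and $h_2(n,\mathcal{H})=O(n^{3/4}\log n)$.
   Context: Edge-colorings of the complete graph $K_n$ use colors from $\{r,b,y\}$ (red, blue, yellow); they need not be proper, and not all colors need be used. A pattern is an edge-colored triangle, denoted by the multiset of the colors of its three edges; e.g. $rrr$ is the all-red triangle, $rrb$ is the triangle with two red edges and one blue edge, and $yyr$ has two yellow edges and one red edge. For a family $\mathcal{H}$ of patterns, $\operatorname{Forb}(n,\mathcal{H})$ is the set of all edge-colorings of $K_n$ with colors from $\{r,b,y\}$ in which no triangle has a coloring belonging to $\mathcal{H}$. For an edge-coloring $c$ of $K_n$, $h_2(c)$ is the maximum $k$ such that there is a set of $k$ vertices whose induced edges use at most two of the three colors. Finally, $h_2(n,\mathcal{H})=\min\{h_2(c): c\in\operatorname{Forb}(n,\mathcal{H})\}$. Here $\log$ is the base-2 logarithm. -}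

module Defs where

open import Data.Nat.Base using (ℕ; zero; suc; _+_; _*_; _^_; _≤_; _<_; _≥_; z≤n; s≤s⁻¹; NonZero)
import Data.Nat.Properties as ℕₚ
open import Data.Fin.Base using (Fin)
open import Data.Fin.Properties as Finₚ using (all?)
open import Data.Fin.Subset using (Subset; _∈_; ∣_∣; ⊥)
open import Data.Fin.Subset.Properties using (_∈?_; ∣p∣≤n; ∣⊥∣≡0; ∉⊥; anySubset?)
open import Data.List.Base using (List; []; _∷_; _++_)
open import Data.List.Membership.Propositional.Properties using (∈-∃++)
import Data.List.Membership.DecPropositional as DecMembership
open import Data.List.Relation.Unary.Any as Any using (Any; here)
open import Data.List.Relation.Binary.Permutation.Propositional
  using (_↭_; ↭-refl; ↭-sym; ↭-trans; prep)
open import Data.List.Relation.Binary.Permutation.Propositional.Properties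
  using (∈-resp-↭; drop-mid; shift; ↭-empty-inv)
open import Data.Product.Base using (Σ; ∃; ∃-syntax; _×_; _,_; proj₁; proj₂)
open import Data.Sum.Base using (_⊎_; inj₁; inj₂)
open import Data.Empty using (⊥-elim)
open import Data.Vec.Base using (Vec; []; _∷_; lookup; tabulate; toList)
open import Data.Vec.Properties using (lookup∘tabulate)
open import Relation.Nullary using (¬_; Dec; yes; no)
open import Relation.Nullary.Decidable using (map′; _×-dec_; _⊎-dec_; _→-dec_; ¬?; from-no)
open import Relation.Binary.Definitions using (DecidableEquality)
open import Relation.Binary.PropositionalEquality
  using (_≡_; _≢_; refl; sym; trans; cong; subst)

data Color : Set where
  red blue yellow : Color

-- The values on the diagonal carry no meaning: every notion below only looks
-- at pairs of distinct vertices.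
record Coloring (n : ℕ) : Set where
  constructor coloring
  field
    color     : Fin n → Fin n → Color
    color-sym : ∀ i j → color i j ≡ color j i

open Coloring public

-- A pattern is read as a multiset: it is only ever compared up to _↭_.
Pattern : Set
Pattern = Vec Color 3

Family : Set
Family = List Pattern

triangle : ∀ {n} → Coloring n → Fin n → Fin n → Fin n → Pattern
triangle c i j k = color c i j ∷ color c j k ∷ color c i k ∷ []

_isInstanceOf_ : Pattern → Family → Set
P isInstanceOf F = Any (λ Q → toList P ↭ toList Q) F

Avoids : ∀ {n} → Coloring n → Family → Set
Avoids c F = ∀ i j k → i ≢ j → j ≢ k → i ≢ k → ¬ (triangle c i j k isInstanceOf F)

Forb : ℕ → Family → Set
Forb n F = Σ (Coloring n) λ c → Avoids c F

UsesAtMostTwoColors : ∀ {n} → Coloring n → Subset n → Set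
UsesAtMostTwoColors c S = ∃[ x ] ∃[ y ]
  (∀ i j → i ∈ S → j ∈ S → i ≢ j → color c i j ≡ x ⊎ color c i j ≡ y)

IsMaximum : (ℕ → Set) → ℕ → Set
IsMaximum P k = P k × (∀ m → P m → m ≤ k)

IsMinimum : (ℕ → Set) → ℕ → Set
IsMinimum P k = P k × (∀ m → P m → k ≤ m)

IsH₂Coloring : ∀ {n} → Coloring n → ℕ → Set
IsH₂Coloring {n} c = IsMaximum λ k → Σ (Subset n) λ S → ∣ S ∣ ≡ k × UsesAtMostTwoColors c S

IsH₂ : ℕ → Family → ℕ → Set
IsH₂ n F = IsMinimum λ k → Σ (Forb n F) λ c → IsH₂Coloring (proj₁ c) k

_≟ᶜ_ : DecidableEquality Color
red    ≟ᶜ red    = yes refl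
red    ≟ᶜ blue   = no λ ()
red    ≟ᶜ yellow = no λ ()
blue   ≟ᶜ red    = no λ ()
blue   ≟ᶜ blue   = yes refl
blue   ≟ᶜ yellow = no λ ()
yellow ≟ᶜ red    = no λ ()
yellow ≟ᶜ blue   = no λ ()
yellow ≟ᶜ yellow = yes refl

open DecMembership _≟ᶜ_ using () renaming (_∈?_ to _∈ˡ?_)

_↭?_ : (xs ys : List Color) → Dec (xs ↭ ys)
[]       ↭? []       = yes ↭-refl
[]       ↭? (y ∷ ys) = no λ p → case-∷ (↭-empty-inv (↭-sym p))
  where
  case-∷ : ¬ (y ∷ ys ≡ [])
  case-∷ ()
(x ∷ xs) ↭? ys with x ∈ˡ? ys
... | no  x∉ys = no λ p → x∉ys (∈-resp-↭ p (here refl))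
... | yes x∈ys with ∈-∃++ x∈ys
...   | as , bs , refl = map′
        (λ p → ↭-trans (prep x p) (↭-sym (shift x as bs)))
        (drop-mid [] as)
        (xs ↭? (as ++ bs))

Searchable : Set → Set₁
Searchable A = ∀ {P : A → Set} → (∀ x → Dec (P x)) → Dec (∃ P)

searchColor : Searchable Color
searchColor {P} P? = map′ to from (P? red ⊎-dec P? blue ⊎-dec P? yellow)
  where
  to : P red ⊎ P blue ⊎ P yellow → ∃ P
  to (inj₁ p)        = red , p
  to (inj₂ (inj₁ p)) = blue , p
  to (inj₂ (inj₂ p)) = yellow , p
  from : ∃ P → P red ⊎ P blue ⊎ P yellow
  from (red , p)    = inj₁ p
  from (blue , p)   = inj₂ (inj₁ p)
  from (yellow , p) = inj₂ (inj₂ p)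

searchVec : ∀ {A} → Searchable A → ∀ n → Searchable (Vec A n)
searchVec s zero    P? = map′ ([] ,_) (λ { ([] , p) → p }) (P? [])
searchVec s (suc n) P? = map′
  (λ { (x , xs , p) → x ∷ xs , p })
  (λ { (x ∷ xs , p) → x , xs , p })
  (s λ x → searchVec s n λ xs → P? (x ∷ xs))

_≈ᶜ_ : ∀ {n} → Coloring n → Coloring n → Set
c ≈ᶜ d = ∀ i j → color c i j ≡ color d i j

≈ᶜ-sym : ∀ {n} {c d : Coloring n} → c ≈ᶜ d → d ≈ᶜ c
≈ᶜ-sym e i j = sym (e i j)

searchColoring : ∀ {n} {P : Coloring n → Set} →
  (∀ {c d} → c ≈ᶜ d → P c → P d) → (∀ c → Dec (P c)) → Dec (∃ P)
searchColoring {n} {P} resp P? =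
  map′ (λ { (M , s , p) → coloring (entry M) s , p }) from
       (searchVec (searchVec searchColor n) n Q?)
  where
  Matrix = Vec (Vec Color n) n
  entry : Matrix → Fin n → Fin n → Color
  entry M i j = lookup (lookup M i) j
  Symmetric = λ M → ∀ i j → entry M i j ≡ entry M j i
  Q : Matrix → Set
  Q M = Σ (Symmetric M) λ s → P (coloring (entry M) s)
  Q? : ∀ M → Dec (Q M)
  Q? M with all? (λ i → all? λ j → entry M i j ≟ᶜ entry M j i)
  ... | no ¬s = no λ { (s , _) → ¬s s }
  ... | yes s = map′ (s ,_) (λ { (_ , p) → resp (λ _ _ → refl) p })
                     (P? (coloring (entry M) s))
  from : ∃ P → ∃ Q
  from (c , p) = M , symM , resp (λ i j → sym (entry-M i j)) p
    where
    M = tabulate λ i → tabulate (color c i)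
    entry-M : ∀ i j → entry M i j ≡ color c i j
    entry-M i j = trans
      (cong (λ v → lookup v j) (lookup∘tabulate (λ i → tabulate (color c i)) i))
      (lookup∘tabulate (color c i) j)
    symM : Symmetric M
    symM i j = trans (entry-M i j) (trans (color-sym c i j) (sym (entry-M j i)))

isInstanceOf? : ∀ P F → Dec (P isInstanceOf F)
isInstanceOf? P F = Any.any? (λ Q → toList P ↭? toList Q) F

avoids? : ∀ {n} (c : Coloring n) F → Dec (Avoids c F)
avoids? c F = all? λ i → all? λ j → all? λ k →
  ¬? (i Finₚ.≟ j) →-dec ¬? (j Finₚ.≟ k) →-dec ¬? (i Finₚ.≟ k) →-dec
  ¬? (isInstanceOf? (triangle c i j k) F)

usesAtMostTwoColors? : ∀ {n} (c : Coloring n) S → Dec (UsesAtMostTwoColors c S)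
usesAtMostTwoColors? c S = searchColor λ x → searchColor λ y → all? λ i → all? λ j →
  (i ∈? S) →-dec (j ∈? S) →-dec ¬? (i Finₚ.≟ j) →-dec
  ((color c i j ≟ᶜ x) ⊎-dec (color c i j ≟ᶜ y))

Avoids-resp : ∀ {n F} {c d : Coloring n} → c ≈ᶜ d → Avoids c F → Avoids d F
Avoids-resp {F = F} {c} {d} e av i j k p q r inst =
  av i j k p q r (subst (_isInstanceOf F) eq inst)
  where
  eq : triangle d i j k ≡ triangle c i j k
  eq rewrite e i j | e j k | e i k = refl

UsesAtMostTwoColors-resp : ∀ {n S} {c d : Coloring n} → c ≈ᶜ d →
  UsesAtMostTwoColors c S → UsesAtMostTwoColors d S
UsesAtMostTwoColors-resp e (x , y , f) = x , y , λ i j p q r →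
  subst (λ z → z ≡ x ⊎ z ≡ y) (e i j) (f i j p q r)

IsH₂Coloring-resp : ∀ {n k} {c d : Coloring n} → c ≈ᶜ d →
  IsH₂Coloring c k → IsH₂Coloring d k
IsH₂Coloring-resp {c = c} {d} e ((S , s , t) , max) =
  (S , s , UsesAtMostTwoColors-resp {c = c} {d} e t) ,
  λ { m (T , u , v) →
      max m (T , u , UsesAtMostTwoColors-resp {c = d} {c} (≈ᶜ-sym {c = c} {d} e) v) }

maximum-exists : ∀ {P : ℕ → Set} → (∀ k → Dec (P k)) → ∃ P →
  ∀ b → (∀ m → P m → m ≤ b) → ∃ (IsMaximum P)
maximum-exists {P} P? (k , p) zero bnd =
  zero , subst P (ℕₚ.n≤0⇒n≡0 (bnd k p)) p , bnd
maximum-exists {P} P? w (suc b) bnd with P? (suc b)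
... | yes p = suc b , p , bnd
... | no ¬p = maximum-exists P? w b λ m q →
  s≤s⁻¹ (ℕₚ.≤∧≢⇒< (bnd m q) λ { refl → ¬p q })

minimum-exists : ∀ {P : ℕ → Set} → (∀ k → Dec (P k)) → ∃ P → ∃ (IsMinimum P)
minimum-exists {P} P? (k , p) = go k 0 (ℕₚ.+-identityʳ k) λ _ _ → z≤n
  where
  go : ∀ d a → d + a ≡ k → (∀ m → P m → a ≤ m) → ∃ (IsMinimum P)
  go zero    a refl low = a , p , low
  go (suc d) a eq   low with P? a
  ... | yes q = a , q , low
  ... | no ¬q = go d (suc a) (trans (ℕₚ.+-suc d a) eq) λ m r →
    ℕₚ.≤∧≢⇒< (low m r) λ { refl → ¬q r }

h₂Coloring-exists : ∀ {n} (c : Coloring n) → ∃ (IsH₂Coloring c)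
h₂Coloring-exists {n} c = maximum-exists
  (λ k → anySubset? λ S → (∣ S ∣ ℕₚ.≟ k) ×-dec usesAtMostTwoColors? c S)
  (0 , ⊥ , ∣⊥∣≡0 n , red , red , λ i j p → ⊥-elim (∉⊥ p))
  n
  λ { m (S , refl , _) → ∣p∣≤n S }

isH₂Coloring? : ∀ {n} (c : Coloring n) k → Dec (IsH₂Coloring c k)
isH₂Coloring? c k with h₂Coloring-exists c
... | m , p , max = map′
  (λ { refl → p , max })
  (λ { (q , max′) → ℕₚ.≤-antisym (max′ m p) (max k q) })
  (m ℕₚ.≟ k)

h₂-exists : ∀ n F → Forb n F → ∃ (IsH₂ n F)
h₂-exists n F (c , av) = minimum-exists
  (λ k → map′ (λ { (d , a , h) → (d , a) , h }) (λ { ((d , a) , h) → d , a , h })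
    (searchColoring
      (λ { {d} {d′} e (a , h) →
           Avoids-resp {c = d} {d′} e a , IsH₂Coloring-resp {c = d} {d′} e h })
      (λ d → avoids? d F ×-dec isH₂Coloring? d k)))
  (let (k , h) = h₂Coloring-exists c in k , (c , av) , h)

-- The minimum over Forb n F only makes sense when Forb n F is inhabited, hence
-- the last argument; the value does not depend on it, by h₂-spec.
abstract
  h₂ : ∀ n F → Forb n F → ℕ
  h₂ n F w = proj₁ (h₂-exists n F w)

  h₂-spec : ∀ n F (w : Forb n F) → IsH₂ n F (h₂ n F w)
  h₂-spec n F w = proj₂ (h₂-exists n F w)

ℋ : Family
ℋ = (red ∷ red ∷ red ∷ [])
  ∷ (red ∷ red ∷ blue ∷ [])
  ∷ (yellow ∷ yellow ∷ red ∷ [])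
  ∷ []

allBlue : ∀ n → Forb n ℋ
allBlue n = coloring (λ _ _ → blue) (λ _ _ → refl) ,
  λ _ _ _ _ _ _ → from-no (isInstanceOf? (blue ∷ blue ∷ blue ∷ []) ℋ)

-- [n^ s ·log^ t ]^1/ e  stands for the function  n ↦ (n^s (log₂ n)^t)^(1/e).
record Growth : Set where
  constructor [n^_·log^_]^1/_
  field
    s t e   : ℕ
    {{e≢0}} : NonZero e

-- p/q ≤ log₂ n  and  log₂ n ≤ p/q, for q > 0.
_/_≤log₂_ : ℕ → ℕ → ℕ → Set
p / q ≤log₂ n = 2 ^ p ≤ n ^ q

log₂_≤_/_ : ℕ → ℕ → ℕ → Set
log₂ n ≤ p / q = n ^ q ≤ 2 ^ p

-- For n ≥ 1 the real number log₂ n is the supremum of the fractions p/q below it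
-- and the infimum of those above it, so, after taking e-th powers and clearing
-- denominators, the following say exactly (for b > 0)
--   (a/b) · g(n) ≤ m   and   m ≤ (a/b) · g(n).
_/_·_at_≤_ : ℕ → ℕ → Growth → ℕ → ℕ → Set
a / b · [n^ s ·log^ t ]^1/ e at n ≤ m =
  ∀ p q → 0 < q → p / q ≤log₂ n →
  a ^ e * (n ^ s * p ^ t) ≤ (b * m) ^ e * q ^ t

_≤_/_·_at_ : ℕ → ℕ → ℕ → Growth → ℕ → Set
m ≤ a / b · [n^ s ·log^ t ]^1/ e at n =
  ∀ p q → 0 < q → log₂ n ≤ p / q →
  (b * m) ^ e * q ^ t ≤ a ^ e * (n ^ s * p ^ t)

-- Positive real constants may be taken rational, shrinking or enlarging them.
_isΩ_ : (ℕ → ℕ) → Growth → Set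
f isΩ g = ∃[ a ] ∃[ b ] ∃[ n₀ ] (0 < a × 0 < b × (∀ n → n ≥ n₀ → a / b · g at n ≤ f n))

_isO_ : (ℕ → ℕ) → Growth → Set
f isO g = ∃[ a ] ∃[ b ] ∃[ n₀ ] (0 < a × 0 < b × (∀ n → n ≥ n₀ → f n ≤ a / b · g at n))

{-# OPTIONS --safe #-}
-- The red edges of an ℋ-free colouring form a graph R without closed walks of length 3
-- or 5: two red edges at a vertex force a yellow third edge, and two yellow edges at a
-- vertex exclude a red third one.  Conversely such an R is coloured by making yellow the
-- non-adjacent pairs with a common red neighbour and blue the rest, and then a vertex set
-- omitting some colour splits into three R-independent sets.  So, up to a factor 3,
-- h₂(n,ℋ) is the least independence number α of such a graph on n vertices.
--
-- Lower bound.  The vertices at distance 1 or 2 from v form independent sets.  Hence one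
-- may repeatedly move the neighbourhood of a vertex of degree > d into an independent set
-- and discard the second neighbourhood, of size at most α.  On what remains, Alon's
-- averaging over all independent sets, fibred over the neighbourhood of each vertex,
-- gives α = Ω(n log d / d); balance with d ≈ α²/n + n^(1/3).
--
-- Upper bound.  Choose a graph g without triangles and pentagons with probability
-- proportional to M^-e(g), M ≈ n^(3/4).  Deleting an edge is a weighted injection, so a
-- given path of length k is present with probability at most M^-k; therefore an edge
-- can be added to at least half of the graphs missing it, and a given m-set is
-- independent with probability at most (1 + 1/2M)^-(m choose 2).  A union bound over
-- m-tuples succeeds for m ≈ M log n.
module Submission where

open import Defs
open import Data.Nat.Base using (nonZero)
open import Data.Product.Base using (_×_)

open import Data.Bool.Base using (Bool; true; false; if_then_else_)
open import Data.Empty using (⊥-elim)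
open import Data.Fin.Base as Fin using (Fin; zero; suc; combine; remQuot)
open import Data.Fin.Properties as Finₚ using (all?; any?; combine-injective; remQuot-combine)
open import Data.Fin.Subset using (Subset; _∈_; _∉_; _⊆_; ∣_∣; inside; outside; ⊥; ⊤; ⁅_⁆; _∪_)
open import Data.Fin.Subset.Properties
  using (_∈?_; _⊆?_; ∉⊥; ⊥⊆; ∈⊤; x∈⁅x⁆; x∈⁅y⁆⇒x≡y; x∈p∪q⁻; x∈p∪q⁺; p⊆q⇒∣p∣≤∣q∣; ∣⊤∣≡n)
open import Data.List.Base as List
  using (List; []; _∷_; _++_; map; length; filter; allFin; take; cartesianProduct; cartesianProductWith)
open import Data.List.Membership.Propositional using () renaming (_∈_ to _∈ˡ_; lose to loseˡ; find to findˡ)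
import Data.List.Membership.Propositional.Properties as ∈ˡ
import Data.List.Properties as Listₚ
open import Data.List.Relation.Binary.Permutation.Propositional using (↭-refl)
open import Data.List.Relation.Unary.All as All using (All; []; _∷_)
import Data.List.Relation.Unary.All.Properties as Allₚ
open import Data.List.Relation.Unary.AllPairs using ([]; _∷_)
open import Data.List.Relation.Unary.Any as Any using (here; there)
open import Data.List.Relation.Unary.Unique.Propositional using (Unique)
import Data.List.Relation.Unary.Unique.Propositional.Properties as Uniqueₚ
import Data.List.Relation.Unary.Unique.DecPropositional as DecUnique
open import Data.Nat.Base
open import Data.Nat.DivMod using (m≡m%n+[m/n]*n; m%n<n)
open import Data.Nat.ListAction using (sum)
open import Data.Nat.ListAction.Properties using (sum-++)
open import Data.Nat.Properties
open import Data.Nat.Tactic.RingSolver using (solve-∀)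
open import Data.Product.Base using (Σ; ∃-syntax; _,_; proj₁; proj₂)
open import Data.Sum.Base using (_⊎_; inj₁; inj₂)
open import Data.Vec.Base using ([]; _∷_; tabulate; _[_]≔_; here; there)
import Data.Vec.Properties as Vecₚ
open import Function.Base using (_∘_; id)
open import Function.Bundles using (mk⇔)
open import Relation.Binary.Definitions using (tri<; tri≈; tri>)
open import Relation.Nullary using (¬_; Dec; yes; no; does)
open import Relation.Nullary.Decidable
  using (¬?; _×-dec_; _→-dec_; _⊎-dec_; map′; from-yes; does-⇔)
open import Relation.Binary.PropositionalEquality

private variable
  X Y P Q : Set
  n : ℕ

-- Sums over lists and over subsets

∑ : List X → (X → ℕ) → ℕ
∑ xs f = sum (map f xs)

syntax ∑ xs (λ x → e) = ∑[ x ∈ xs ] e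

∑-mono : ∀ (xs : List X) {f g : X → ℕ} → (∀ x → x ∈ˡ xs → f x ≤ g x) → ∑ xs f ≤ ∑ xs g
∑-mono []       h = z≤n
∑-mono (x ∷ xs) h = +-mono-≤ (h x (here refl)) (∑-mono xs λ y i → h y (there i))

∑-cong : ∀ (xs : List X) {f g : X → ℕ} → (∀ x → x ∈ˡ xs → f x ≡ g x) → ∑ xs f ≡ ∑ xs g
∑-cong xs h = ≤-antisym (∑-mono xs λ x i → ≤-reflexive (h x i))
                        (∑-mono xs λ x i → ≤-reflexive (sym (h x i)))

+-interchange : ∀ a b c d → a + b + (c + d) ≡ a + c + (b + d)
+-interchange = solve-∀

∑-+ : ∀ (xs : List X) (f g : X → ℕ) → ∑ xs (λ x → f x + g x) ≡ ∑ xs f + ∑ xs g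
∑-+ []       f g = refl
∑-+ (x ∷ xs) f g = trans (cong (f x + g x +_) (∑-+ xs f g)) (+-interchange (f x) (g x) _ _)

∑-*ˡ : ∀ c (xs : List X) (f : X → ℕ) → ∑ xs (λ x → c * f x) ≡ c * ∑ xs f
∑-*ˡ c []       f = sym (*-zeroʳ c)
∑-*ˡ c (x ∷ xs) f = trans (cong (c * f x +_) (∑-*ˡ c xs f)) (sym (*-distribˡ-+ c (f x) _))

∑-const : ∀ (xs : List X) c → ∑ xs (λ _ → c) ≡ length xs * c
∑-const []       c = refl
∑-const (x ∷ xs) c = cong (c +_) (∑-const xs c)

∑-bound : ∀ (xs : List X) {f : X → ℕ} {c} → (∀ x → x ∈ˡ xs → f x ≤ c) → ∑ xs f ≤ length xs * c
∑-bound xs h = ≤-trans (∑-mono xs h) (≤-reflexive (∑-const xs _))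

∑-swap : ∀ (xs : List X) (ys : List Y) (f : X → Y → ℕ) →
  ∑[ x ∈ xs ] ∑[ y ∈ ys ] f x y ≡ ∑[ y ∈ ys ] ∑[ x ∈ xs ] f x y
∑-swap []       ys f = sym (trans (∑-const ys 0) (*-zeroʳ (length ys)))
∑-swap (x ∷ xs) ys f = trans (cong (∑ ys (f x) +_) (∑-swap xs ys f))
                             (sym (∑-+ ys (f x) λ y → ∑ xs λ x′ → f x′ y))

∈⇒≤∑ : ∀ {xs : List X} {x} (f : X → ℕ) → x ∈ˡ xs → f x ≤ ∑ xs f
∈⇒≤∑ f (here refl) = m≤m+n _ _
∈⇒≤∑ f (there i)   = ≤-trans (∈⇒≤∑ f i) (m≤n+m _ _)

⟦_⟧ : {P : Set} → Dec P → ℕ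
⟦ P? ⟧ = if does P? then 1 else 0

⟦⟧-yes : P → (P? : Dec P) → ⟦ P? ⟧ ≡ 1
⟦⟧-yes p (yes _) = refl
⟦⟧-yes p (no ¬p) = ⊥-elim (¬p p)

⟦⟧-no : ¬ P → (P? : Dec P) → ⟦ P? ⟧ ≡ 0
⟦⟧-no ¬p (yes p) = ⊥-elim (¬p p)
⟦⟧-no ¬p (no _)  = refl

⟦⟧≤ : (P? : Dec P) {m : ℕ} → (P → 1 ≤ m) → ⟦ P? ⟧ ≤ m
⟦⟧≤ (yes p) h = h p
⟦⟧≤ (no _)  h = z≤n

⟦⟧-mono : (P → Q) → (P? : Dec P) (Q? : Dec Q) → ⟦ P? ⟧ ≤ ⟦ Q? ⟧
⟦⟧-mono f P? Q? = ⟦⟧≤ P? λ p → ≤-reflexive (sym (⟦⟧-yes (f p) Q?))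

⟦⟧-cong : (P → Q) → (Q → P) → (P? : Dec P) (Q? : Dec Q) → ⟦ P? ⟧ ≡ ⟦ Q? ⟧
⟦⟧-cong f g P? Q? = ≤-antisym (⟦⟧-mono f P? Q?) (⟦⟧-mono g Q? P?)

⟦⟧≤1 : (P? : Dec P) → ⟦ P? ⟧ ≤ 1
⟦⟧≤1 P? = ⟦⟧≤ P? λ _ → ≤-refl

⟦⟧*-≤ : (P? : Dec P) {k m : ℕ} → (P → k ≤ m) → ⟦ P? ⟧ * k ≤ m
⟦⟧*-≤ (yes p) h = ≤-trans (≤-reflexive (+-identityʳ _)) (h p)
⟦⟧*-≤ (no _)  h = z≤n

⟦⟧*-mono : (P? : Dec P) {k m : ℕ} → (P → k ≤ m) → ⟦ P? ⟧ * k ≤ ⟦ P? ⟧ * m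
⟦⟧*-mono (yes p) h = +-monoˡ-≤ 0 (h p)
⟦⟧*-mono (no _)  h = z≤n

⟦⟧*-cong : (P? : Dec P) {k m : ℕ} → (P → k ≡ m) → ⟦ P? ⟧ * k ≡ ⟦ P? ⟧ * m
⟦⟧*-cong (yes p) h = cong (_+ 0) (h p)
⟦⟧*-cong (no _)  h = refl

⟦⟧+⟦¬⟧ : (P? : Dec P) (m : ℕ) → ⟦ P? ⟧ * m + ⟦ ¬? P? ⟧ * m ≡ m
⟦⟧+⟦¬⟧ (yes _) m = trans (+-identityʳ (m + 0)) (+-identityʳ m)
⟦⟧+⟦¬⟧ (no _)  m = +-identityʳ m

length-filter-∑ : ∀ {P : X → Set} (P? : ∀ x → Dec (P x)) xs → length (filter P? xs) ≡ ∑[ x ∈ xs ] ⟦ P? x ⟧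
length-filter-∑ P? []       = refl
length-filter-∑ P? (x ∷ xs) with P? x
... | yes _ = cong suc (length-filter-∑ P? xs)
... | no _  = length-filter-∑ P? xs

∑-filter : ∀ {P : X → Set} (P? : ∀ x → Dec (P x)) f xs → ∑ (filter P? xs) f ≡ ∑[ x ∈ xs ] (⟦ P? x ⟧ * f x)
∑-filter P? f []       = refl
∑-filter P? f (x ∷ xs) with P? x
... | yes _ = cong₂ _+_ (sym (+-identityʳ (f x))) (∑-filter P? f xs)
... | no _  = ∑-filter P? f xs

∣_∣≡∑ : ∀ (p : Subset n) → ∣ p ∣ ≡ ∑[ i ∈ allFin n ] ⟦ i ∈? p ⟧
∣ [] ∣≡∑      = refl
∣_∣≡∑ {suc n} (s ∷ p) = trans (head-tail s) (cong (⟦ zero ∈? (s ∷ p) ⟧ +_) tail-sum)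
  where
  head-tail : ∀ s → ∣ s ∷ p ∣ ≡ ⟦ zero ∈? (s ∷ p) ⟧ + ∣ p ∣
  head-tail true  = refl
  head-tail false = refl
  tail-sum : ∣ p ∣ ≡ ∑ (List.tabulate suc) (λ i → ⟦ i ∈? (s ∷ p) ⟧)
  tail-sum = trans ∣ p ∣≡∑ (cong sum (trans (Listₚ.map-tabulate {n = n} id _)
    (sym (Listₚ.map-tabulate {n = n} suc _))))

_⊕_ : Subset n → Fin n → Subset n
g ⊕ a = g [ a ]≔ inside

∈-⊕ : ∀ (g : Subset n) a → a ∈ g ⊕ a
∈-⊕ g a = Vecₚ.[]≔-updates g a

⊆-⊕ : ∀ (g : Subset n) {a x} → x ∈ g → x ∈ g ⊕ a
⊆-⊕ (_ ∷ g) {zero}  here      = here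
⊆-⊕ (_ ∷ g) {suc a} here      = here
⊆-⊕ (_ ∷ g) {zero}  (there i) = there i
⊆-⊕ (_ ∷ g) {suc a} (there i) = there (⊆-⊕ g i)

∈-⊕⁻ : ∀ (g : Subset n) {a x} → x ∈ g ⊕ a → x ≡ a ⊎ x ∈ g
∈-⊕⁻ (_ ∷ g) {zero}  here      = inj₁ refl
∈-⊕⁻ (_ ∷ g) {suc a} here      = inj₂ here
∈-⊕⁻ (_ ∷ g) {zero}  (there i) = inj₂ (there i)
∈-⊕⁻ (_ ∷ g) {suc a} (there i) with ∈-⊕⁻ g i
... | inj₁ refl = inj₁ refl
... | inj₂ j    = inj₂ (there j)

subset : {P : Fin n → Set} → (∀ i → Dec (P i)) → Subset n
subset P? = tabulate λ i → does (P? i)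

∈-subset⁺ : {P : Fin n → Set} (P? : ∀ i → Dec (P i)) → ∀ {i} → P i → i ∈ subset P?
∈-subset⁺ P? {zero}  p with P? zero
... | yes _ = here
... | no ¬p = ⊥-elim (¬p p)
∈-subset⁺ P? {suc i} p = there (∈-subset⁺ (P? ∘ suc) p)

∈-subset⁻ : {P : Fin n → Set} (P? : ∀ i → Dec (P i)) → ∀ {i} → i ∈ subset P? → P i
∈-subset⁻ P? {zero}  q with P? zero
∈-subset⁻ P? {zero}  here | yes p = p
∈-subset⁻ P? {suc i} (there q) = ∈-subset⁻ (P? ∘ suc) q

∣subset∣ : {P : Fin n → Set} (P? : ∀ i → Dec (P i)) → ∣ subset P? ∣ ≡ ∑[ i ∈ allFin n ] ⟦ P? i ⟧
∣subset∣ {n} P? = trans ∣ subset P? ∣≡∑ (∑-cong (allFin n) λ i _ →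
  ⟦⟧-cong (∈-subset⁻ P?) (∈-subset⁺ P?) (i ∈? subset P?) (P? i))

module Weighted (M : ℕ) where

  -- The partition function of a random subset: every absent element contributes a factor `M`, so
  -- `g` carries weight M^(n - |g|), that is M^-|g| scaled to an integer. `M` = 1 is plain counting.
  tot : (Subset n → ℕ) → ℕ
  tot {zero}  F = F []
  tot {suc n} F = M * tot (λ g → F (outside ∷ g)) + tot (λ g → F (inside ∷ g))

  tot-mono : {F G : Subset n → ℕ} → (∀ g → F g ≤ G g) → tot F ≤ tot G
  tot-mono {zero}  h = h []
  tot-mono {suc n} h = +-mono-≤ (*-monoʳ-≤ M (tot-mono (h ∘ (outside ∷_)))) (tot-mono (h ∘ (inside ∷_)))

  tot-cong : {F G : Subset n → ℕ} → (∀ g → F g ≡ G g) → tot F ≡ tot G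
  tot-cong h = ≤-antisym (tot-mono (≤-reflexive ∘ h)) (tot-mono (≤-reflexive ∘ sym ∘ h))

  tot-+ : (F G : Subset n → ℕ) → tot (λ g → F g + G g) ≡ tot F + tot G
  tot-+ {zero}  F G = refl
  tot-+ {suc n} F G = trans
    (cong₂ (λ a b → M * a + b) (tot-+ (F ∘ (outside ∷_)) _) (tot-+ (F ∘ (inside ∷_)) _))
    (regroup M (tot (F ∘ (outside ∷_))) (tot (G ∘ (outside ∷_))) _ _)
    where
    regroup : ∀ M a b c d → M * (a + b) + (c + d) ≡ M * a + c + (M * b + d)
    regroup = solve-∀

  tot-*ˡ : ∀ c (F : Subset n → ℕ) → tot (λ g → c * F g) ≡ c * tot F
  tot-*ˡ {zero}  c F = refl
  tot-*ˡ {suc n} c F = trans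
    (cong₂ (λ a b → M * a + b) (tot-*ˡ c (F ∘ (outside ∷_))) (tot-*ˡ c (F ∘ (inside ∷_))))
    (pull M c _ _)
    where
    pull : ∀ M c a b → M * (c * a) + c * b ≡ c * (M * a + b)
    pull = solve-∀

  tot-0 : tot {n} (λ _ → 0) ≡ 0
  tot-0 {n} = tot-*ˡ {n} 0 (λ _ → 0)

  tot-∑ : ∀ (xs : List X) (F : X → Subset n → ℕ) → tot (λ g → ∑[ x ∈ xs ] F x g) ≡ ∑[ x ∈ xs ] tot (F x)
  tot-∑ {n = n} []       F = tot-0 {n}
  tot-∑ (x ∷ xs) F = trans (tot-+ (F x) _) (cong (tot (F x) +_) (tot-∑ xs F))

  -- The first moment method: a strict inequality between weighted averages has to show at some
  -- single set.
  tot-<-exists : (F G : Subset n → ℕ) → tot F < tot G → ∃[ g ] F g < G g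
  tot-<-exists {zero}  F G lt = [] , lt
  tot-<-exists {suc n} F G lt
    with tot (F ∘ (outside ∷_)) <? tot (G ∘ (outside ∷_)) | tot (F ∘ (inside ∷_)) <? tot (G ∘ (inside ∷_))
  ... | yes p | _     = let g , q = tot-<-exists _ _ p in outside ∷ g , q
  ... | no _  | yes p = let g , q = tot-<-exists _ _ p in inside ∷ g , q
  ... | no p  | no q  = ⊥-elim (<⇒≱ lt (+-mono-≤ (*-monoʳ-≤ M (≮⇒≥ p)) (≮⇒≥ q)))

  tot-positive : .{{NonZero M}} → (F : Subset n → ℕ) (g : Subset n) → 0 < F g → 0 < tot F
  tot-positive F []            lt = lt
  tot-positive F (outside ∷ g) lt = <-≤-trans
    (≤-trans (tot-positive (F ∘ (outside ∷_)) g lt) (m≤n*m _ M)) (m≤m+n _ _)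
  tot-positive F (inside ∷ g)  lt = <-≤-trans (tot-positive (F ∘ (inside ∷_)) g lt) (m≤n+m _ _)

  tot-split : ∀ a (F : Subset n → ℕ) →
    tot F ≡ tot (λ g → ⟦ a ∈? g ⟧ * F g) + tot (λ g → ⟦ ¬? (a ∈? g) ⟧ * F g)
  tot-split {n} a F = trans (tot-cong λ g → sym (⟦⟧+⟦¬⟧ (a ∈? g) (F g))) (tot-+ {n} _ _)

  -- Removing `a` is a bijection from the sets containing it to those missing it and multiplies the
  -- weight by `M`. Both halves of the proof rest on this exchange.
  toggle : ∀ a (F : Subset n → ℕ) →
    M * tot (λ g → ⟦ a ∈? g ⟧ * F g) ≡ tot (λ g → ⟦ ¬? (a ∈? g) ⟧ * F (g ⊕ a))
  toggle {suc n} zero    F = trans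
    (cong₂ (λ x y → M * (M * x + y)) (tot-0 {n}) (tot-cong λ g → +-identityʳ (F (inside ∷ g))))
    (trans (cong (λ x → M * (x + tot (F ∘ (inside ∷_)))) (*-zeroʳ M))
    (trans (sym (+-identityʳ _))
    (cong₂ (λ x y → M * x + y) (tot-cong λ g → sym (+-identityʳ (F (inside ∷ g)))) (sym (tot-0 {n})))))
  toggle {suc n} (suc a) F = trans
    (pull M _ _)
    (cong₂ (λ x y → M * x + y) (toggle a (F ∘ (outside ∷_))) (toggle a (F ∘ (inside ∷_))))
    where
    pull : ∀ M x y → M * (M * x + y) ≡ M * (M * x) + M * y
    pull = solve-∀

-- Independent sets in sparse graphs

-- Forbidding closed walks instead of cycles spares all distinctness conditions; a loop is itself a
-- closed walk of length 3, whence `irrefl`.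
record Graph (n : ℕ) : Set₁ where
  field
    E    : Fin n → Fin n → Set
    E?   : ∀ i j → Dec (E i j)
    E-sym : ∀ {i j} → E i j → E j i
    no-3-walk : ∀ {i j k} → E i j → E j k → ¬ E k i
    no-5-walk : ∀ {i j k l m} → E i j → E j k → E k l → E l m → ¬ E m i

  irrefl : ∀ {i} → ¬ E i i
  irrefl e = no-3-walk e e e

  Independent : Subset n → Set
  Independent W = ∀ i j → i ∈ W → j ∈ W → ¬ E i j

  independent? : ∀ W → Dec (Independent W)
  independent? W = all? λ i → all? λ j → (i ∈? W) →-dec (j ∈? W) →-dec ¬? (E? i j)

  α≤_ : ℕ → Set
  α≤ h = ∀ W → Independent W → ∣ W ∣ ≤ h

  nbrs : Fin n → Subset n → Subset n
  nbrs v U = subset λ u → E? v u ×-dec (u ∈? U)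

-- The hard-core model at fugacity 1, that is, a uniformly random independent subset of `U`.
module HardCore (G : Graph n) (U : Subset n) where
  open Graph G
  open Weighted 1

  Config : Subset n → Set
  Config W = Independent W × W ⊆ U

  abstract
    config? : ∀ W → Dec (Config W)
    config? W = independent? W ×-dec (W ⊆? U)

  Free : Fin n → Subset n → Set
  Free u W = ∀ w → w ∈ W → ¬ E u w

  abstract
    free? : ∀ u W → Dec (Free u W)
    free? u W = all? λ w → (w ∈? W) →-dec ¬? (E? u w)

  #free : List (Fin n) → Subset n → ℕ
  #free us W = ∑[ u ∈ us ] ⟦ free? u W ⟧

  config-⊕ : ∀ {W u} → Config W → u ∈ U → Free u W → Config (W ⊕ u)
  config-⊕ {W} {u} (ind , sub) u∈U free = ind′ , sub′
    where
    ind′ : Independent (W ⊕ u)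
    ind′ i j i∈ j∈ e with ∈-⊕⁻ W i∈ | ∈-⊕⁻ W j∈
    ... | inj₁ refl | inj₁ refl = irrefl e
    ... | inj₁ refl | inj₂ q    = free j q e
    ... | inj₂ p    | inj₁ refl = free i p (E-sym e)
    ... | inj₂ p    | inj₂ q    = ind i j p q e
    sub′ : W ⊕ u ⊆ U
    sub′ i∈ with ∈-⊕⁻ W i∈
    ... | inj₁ refl = u∈U
    ... | inj₂ p    = sub p

  config-⊕⁻ : ∀ {W u} → Config (W ⊕ u) → Config W × Free u W
  config-⊕⁻ {W} {u} (ind , sub) =
    ((λ i j p q → ind i j (⊆-⊕ W p) (⊆-⊕ W q)) , λ p → sub (⊆-⊕ W p)) ,
    λ w p → ind u w (∈-⊕ W u) (⊆-⊕ W p)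

  -- The occupation probability of `u` multiplied by the partition function, so that no division
  -- occurs.
  occ : Fin n → ℕ
  occ u = tot λ W → ⟦ u ∈? W ⟧ * ⟦ config? W ⟧

  module At (v : Fin n) where

    Nearby : Fin n → Set
    Nearby u = E v u × u ∈ U

    -- For empty `us` only `v` is excluded; for the list of all neighbours of `v` in `U` the closed
    -- neighbourhood is. `fibre` passes from the first to the second one neighbour at a time.
    Off : List (Fin n) → Subset n → Set
    Off us W = Config W × v ∉ W × All (_∉ W) us

    abstract
      off? : ∀ us W → Dec (Off us W)
      off? us W = config? W ×-dec ¬? (v ∈? W) ×-dec All.all? (λ u → ¬? (u ∈? W)) us

    -- An edge between `u` and `u′` would close a triangle with `v`, so occupying one neighbour of
    -- `v` blocks no other.
    free-⊕ : ∀ {u u′ W} → E v u → E v u′ → Free u′ W → Free u′ (W ⊕ u)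
    free-⊕ {W = W} e e′ f w w∈ a with ∈-⊕⁻ W w∈
    ... | inj₁ refl = no-3-walk e′ a (E-sym e)
    ... | inj₂ p    = f w p a

    #free-⊕ : ∀ {u us} W → E v u → All Nearby us → #free us (W ⊕ u) ≡ #free us W
    #free-⊕ {us = us} W e near = ∑-cong us λ u′ i → ⟦⟧-cong
      (λ f w p → f w (⊆-⊕ W p)) (free-⊕ e (proj₁ (All.lookup near i)))
      (free? u′ _) (free? u′ W)

    off-⊕ : ∀ {u us W} → Nearby u → All (u ≢_) us → u ∉ W → Off us W → Free u W → Off us (W ⊕ u)
    off-⊕ {u} {us} {W} (e , u∈U) u∉us u∉W (c , v∉ , offs) f =
      config-⊕ c u∈U f , v∉′ , All.zipWith (λ (u≢w , w∉W) → off u≢w w∉W) (u∉us , offs)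
      where
      off : ∀ {w} → u ≢ w → w ∉ W → w ∉ W ⊕ u
      off u≢w w∉W i with ∈-⊕⁻ W i
      ... | inj₁ refl = u≢w refl
      ... | inj₂ p    = w∉W p
      v∉′ : v ∉ W ⊕ u
      v∉′ = off (λ { refl → irrefl e }) v∉

    off-⊕⁻ : ∀ {u us W} → Off us (W ⊕ u) → Off us W × Free u W
    off-⊕⁻ {W = W} (c , v∉ , offs) = let c′ , f = config-⊕⁻ c in
      (c′ , (λ p → v∉ (⊆-⊕ W p)) , All.map (λ w∉ p → w∉ (⊆-⊕ W p)) offs) , f

    -- A configuration off us is extended by an arbitrary set of its free vertices in us.
    fibre : ∀ us → All Nearby us → Unique us → (K : Subset n → ℕ) →
      (∀ {u} W → E v u → K (W ⊕ u) ≡ K W) →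
      tot (λ W → ⟦ off? [] W ⟧ * K W) ≡ tot (λ W → ⟦ off? us W ⟧ * (2 ^ #free us W * K W))
    fibre []       near uniq K inv = tot-cong λ W → cong (⟦ off? [] W ⟧ *_) (sym (+-identityʳ (K W)))
    fibre (u ∷ us) (nu ∷ near) (u∉us ∷ uniq) K inv = begin
      tot (λ W → ⟦ off? [] W ⟧ * K W)
        ≡⟨ fibre us near uniq K inv ⟩
      tot H
        ≡⟨ tot-split u H ⟩
      tot (λ W → ⟦ u ∈? W ⟧ * H W) + tot (λ W → ⟦ ¬? (u ∈? W) ⟧ * H W)
        ≡⟨ cong (_+ tot (λ W → ⟦ ¬? (u ∈? W) ⟧ * H W)) (trans (sym (*-identityˡ (tot (λ W → ⟦ u ∈? W ⟧ * H W)))) (toggle u H)) ⟩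
      tot (λ W → ⟦ ¬? (u ∈? W) ⟧ * H (W ⊕ u)) + tot (λ W → ⟦ ¬? (u ∈? W) ⟧ * H W)
        ≡⟨ sym (tot-+ (λ W → ⟦ ¬? (u ∈? W) ⟧ * H (W ⊕ u)) (λ W → ⟦ ¬? (u ∈? W) ⟧ * H W)) ⟩
      tot (λ W → ⟦ ¬? (u ∈? W) ⟧ * H (W ⊕ u) + ⟦ ¬? (u ∈? W) ⟧ * H W)
        ≡⟨ tot-cong pointwise ⟩
      tot (λ W → ⟦ off? (u ∷ us) W ⟧ * (2 ^ #free (u ∷ us) W * K W)) ∎
      where
      open ≡-Reasoning
      H : Subset n → ℕ
      H W = ⟦ off? us W ⟧ * (2 ^ #free us W * K W)
      twice : ∀ a b c → a * (b * c) + 0 + (a * (b * c) + 0) ≡ a * (2 * b * c)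
      twice = solve-∀
      once : ∀ a x → 0 * x + 0 + (a + 0) ≡ a
      once a x = +-identityʳ a
      pointwise : ∀ W → ⟦ ¬? (u ∈? W) ⟧ * H (W ⊕ u) + ⟦ ¬? (u ∈? W) ⟧ * H W
        ≡ ⟦ off? (u ∷ us) W ⟧ * (2 ^ #free (u ∷ us) W * K W)
      pointwise W with u ∈? W
      ... | yes u∈W = sym (cong (_* (2 ^ #free (u ∷ us) W * K W))
                        (⟦⟧-no (λ { (_ , _ , u∉W ∷ _) → u∉W u∈W }) (off? (u ∷ us) W)))
      ... | no u∉W
        rewrite #free-⊕ W (proj₁ nu) near | inv W (proj₁ nu)
              | ⟦⟧-cong (λ { (c , v∉ , _ ∷ o) → c , v∉ , o }) (λ { (c , v∉ , o) → c , v∉ , u∉W ∷ o })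
                  (off? (u ∷ us) W) (off? us W)
        with free? u W
      -- A free `u` may be put in or left out, which doubles the fibre; a blocked one can only be
      -- left out.
      ... | yes f
        rewrite ⟦⟧-cong (λ o → proj₁ (off-⊕⁻ o)) (λ o → off-⊕ nu u∉us u∉W o f) (off? us (W ⊕ u)) (off? us W)
        = twice ⟦ off? us W ⟧ (2 ^ #free us W) (K W)
      ... | no ¬f
        rewrite ⟦⟧-no (λ o → ¬f (proj₂ (off-⊕⁻ o))) (off? us (W ⊕ u))
        = once (⟦ off? us W ⟧ * (2 ^ #free us W * K W)) (2 ^ #free us W * K W)

    nbrList : List (Fin n)
    nbrList = filter (λ u → E? v u ×-dec (u ∈? U)) (allFin n)

    nearby : All Nearby nbrList
    nearby = Allₚ.all-filter (λ u → E? v u ×-dec (u ∈? U)) (allFin n)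

    nbrList-unique : Unique nbrList
    nbrList-unique = Uniqueₚ.filter⁺ (λ u → E? v u ×-dec (u ∈? U)) (Uniqueₚ.allFin⁺ n)

    -- Taking `v` out of a configuration leaves one that avoids the closed neighbourhood, and `v`
    -- can be put back into any such one. So each fibre has exactly one member containing `v`.
    occ-centre : v ∈ U → occ v ≡ tot (λ W → ⟦ off? nbrList W ⟧)
    occ-centre v∈U = trans (sym (*-identityˡ (occ v))) (trans (toggle v (λ W → ⟦ config? W ⟧)) (tot-cong pointwise))
      where
      to : ∀ {W} → v ∉ W → Config (W ⊕ v) → Off nbrList W
      to v∉ c = let c′ , f = config-⊕⁻ c in c′ , v∉ , All.map (λ (e , _) i → f _ i e) nearby
      from : ∀ {W} → Off nbrList W → Config (W ⊕ v)
      from (c , v∉ , o) = config-⊕ c v∈U λ w w∈ e →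
        All.lookup o (∈ˡ.∈-filter⁺ (λ u → E? v u ×-dec (u ∈? U)) (∈ˡ.∈-allFin w) (e , proj₂ c w∈)) w∈
      pointwise : ∀ W → ⟦ ¬? (v ∈? W) ⟧ * ⟦ config? (W ⊕ v) ⟧ ≡ ⟦ off? nbrList W ⟧
      pointwise W with v ∈? W
      ... | yes v∈ = sym (⟦⟧-no (λ { (_ , v∉ , _) → v∉ v∈ }) (off? nbrList W))
      ... | no v∉  = trans (+-identityʳ _) (⟦⟧-cong (to v∉) from (config? (W ⊕ v)) (off? nbrList W))

    occ-split : tot (λ W → ⟦ config? W ⟧) ≡ occ v + tot (λ W → ⟦ off? [] W ⟧)
    occ-split = trans (tot-split v (λ W → ⟦ config? W ⟧)) (cong (occ v +_) (tot-cong pointwise))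
      where
      pointwise : ∀ W → ⟦ ¬? (v ∈? W) ⟧ * ⟦ config? W ⟧ ≡ ⟦ off? [] W ⟧
      pointwise W with v ∈? W
      ... | yes v∈ = sym (⟦⟧-no (λ { (_ , v∉ , _) → v∉ v∈ }) (off? [] W))
      ... | no v∉  = trans (+-identityʳ _)
        (⟦⟧-cong (λ c → c , v∉ , []) proj₁ (config? W) (off? [] W))

    -- A configuration in which `u` is free either contains `u` already or can be extended by it;
    -- `occ u` bounds the number of each kind.
    free≤occ : ∀ {u} → Nearby u → tot (λ W → ⟦ off? [] W ⟧ * ⟦ free? u W ⟧) ≤ 2 * occ u
    free≤occ {u} (e , u∈U) = begin
      tot F                                                ≡⟨ tot-split u F ⟩
      tot (λ W → ⟦ u ∈? W ⟧ * F W) + tot (λ W → ⟦ ¬? (u ∈? W) ⟧ * F W)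
        ≤⟨ +-mono-≤ (tot-mono inner) (tot-mono outer) ⟩
      occ u + tot (λ W → ⟦ ¬? (u ∈? W) ⟧ * ⟦ config? (W ⊕ u) ⟧)
        ≡⟨ cong (occ u +_) (sym (toggle u (λ W → ⟦ config? W ⟧))) ⟩
      2 * occ u                                            ∎
      where
      open ≤-Reasoning
      F : Subset n → ℕ
      F W = ⟦ off? [] W ⟧ * ⟦ free? u W ⟧
      inner : ∀ W → ⟦ u ∈? W ⟧ * F W ≤ ⟦ u ∈? W ⟧ * ⟦ config? W ⟧
      inner W = *-monoʳ-≤ ⟦ u ∈? W ⟧ (⟦⟧*-≤ (off? [] W) λ (c , _) →
        ≤-trans (⟦⟧≤1 (free? u W)) (≤-reflexive (sym (⟦⟧-yes c (config? W)))))
      outer : ∀ W → ⟦ ¬? (u ∈? W) ⟧ * F W ≤ ⟦ ¬? (u ∈? W) ⟧ * ⟦ config? (W ⊕ u) ⟧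
      outer W = *-monoʳ-≤ ⟦ ¬? (u ∈? W) ⟧ (⟦⟧*-≤ (off? [] W) λ (c , _) →
        ⟦⟧-mono (config-⊕ c u∈U) (free? u W) (config? (W ⊕ u)))

    -- Alon's local inequality. Over a base configuration with `x` free neighbours of `v` lie one
    -- configuration with `v` and 2^x without, the latter containing x/2 neighbours on average.
    -- Hence d·[v ∈ W] + |W ∩ N(v)| has mean at least `L` once L(1 + 2^x) ≤ d + x·2^x/2 for every
    -- `x`.
    local : v ∈ U → ∀ {L d} → (∀ x → 2 * L * suc (2 ^ x) ≤ 2 * d + 2 ^ x * x) →
      L * tot (λ W → ⟦ config? W ⟧) ≤ d * occ v + ∑ nbrList occ
    local v∈U {L} {d} num = *-cancelˡ-≤ 2 (begin
      2 * (L * tot (λ W → ⟦ config? W ⟧))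
        ≡⟨ sym (*-assoc 2 L _) ⟩
      2 * L * tot (λ W → ⟦ config? W ⟧)
        ≡⟨ cong (2 * L *_) total ⟩
      2 * L * tot (λ W → ⟦ off? N W ⟧ * suc (2 ^ x W))
        ≡⟨ sym (tot-*ˡ (2 * L) (λ W → ⟦ off? N W ⟧ * suc (2 ^ x W))) ⟩
      tot (λ W → 2 * L * (⟦ off? N W ⟧ * suc (2 ^ x W)))
        ≤⟨ tot-mono pointwise ⟩
      tot (λ W → 2 * d * ⟦ off? N W ⟧ + ⟦ off? N W ⟧ * (2 ^ x W * x W))
        ≡⟨ tot-+ (λ W → 2 * d * ⟦ off? N W ⟧) (λ W → ⟦ off? N W ⟧ * (2 ^ x W * x W)) ⟩
      tot (λ W → 2 * d * ⟦ off? N W ⟧) + tot (λ W → ⟦ off? N W ⟧ * (2 ^ x W * x W))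
        ≡⟨ cong₂ _+_ (trans (tot-*ˡ (2 * d) (λ W → ⟦ off? N W ⟧)) (cong (2 * d *_) (sym (occ-centre v∈U))))
                     (sym (fibre N nearby nbrList-unique x λ W e → #free-⊕ W e nearby)) ⟩
      2 * d * occ v + tot (λ W → ⟦ off? [] W ⟧ * x W)
        ≤⟨ +-monoʳ-≤ (2 * d * occ v) nbrs-bound ⟩
      2 * d * occ v + 2 * ∑ N occ
        ≡⟨ regroup d (occ v) (∑ N occ) ⟩
      2 * (d * occ v + ∑ N occ) ∎)
      where
      open ≤-Reasoning
      N = nbrList
      x = #free N
      regroup : ∀ d a b → 2 * d * a + 2 * b ≡ 2 * (d * a + b)
      regroup = solve-∀
      expand : ∀ a b → a + a * (b * 1) ≡ a * suc b
      expand = solve-∀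
      total : tot (λ W → ⟦ config? W ⟧) ≡ tot (λ W → ⟦ off? N W ⟧ * suc (2 ^ x W))
      total = trans occ-split (trans
        (cong₂ _+_ (occ-centre v∈U)
          (trans (tot-cong λ W → sym (*-identityʳ ⟦ off? [] W ⟧))
                 (fibre N nearby nbrList-unique (λ _ → 1) λ _ _ → refl)))
        (trans (sym (tot-+ (λ W → ⟦ off? N W ⟧) (λ W → ⟦ off? N W ⟧ * (2 ^ x W * 1))))
               (tot-cong λ W → expand ⟦ off? N W ⟧ (2 ^ x W))))
      swap* : ∀ a b c → a * (b * c) ≡ b * (a * c)
      swap* = solve-∀
      distr : ∀ a b c → a * (b + c) ≡ b * a + a * c
      distr = solve-∀
      pointwise : ∀ W → 2 * L * (⟦ off? N W ⟧ * suc (2 ^ x W))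
        ≤ 2 * d * ⟦ off? N W ⟧ + ⟦ off? N W ⟧ * (2 ^ x W * x W)
      pointwise W = begin
        2 * L * (⟦ off? N W ⟧ * suc (2 ^ x W))   ≡⟨ swap* (2 * L) ⟦ off? N W ⟧ _ ⟩
        ⟦ off? N W ⟧ * (2 * L * suc (2 ^ x W))   ≤⟨ *-monoʳ-≤ ⟦ off? N W ⟧ (num (x W)) ⟩
        ⟦ off? N W ⟧ * (2 * d + 2 ^ x W * x W)   ≡⟨ distr ⟦ off? N W ⟧ (2 * d) _ ⟩
        2 * d * ⟦ off? N W ⟧ + ⟦ off? N W ⟧ * (2 ^ x W * x W) ∎
      nbrs-bound : tot (λ W → ⟦ off? [] W ⟧ * x W) ≤ 2 * ∑ N occ
      nbrs-bound = begin
        tot (λ W → ⟦ off? [] W ⟧ * x W)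
          ≡⟨ tot-cong (λ W → sym (∑-*ˡ ⟦ off? [] W ⟧ N (λ u → ⟦ free? u W ⟧))) ⟩
        tot (λ W → ∑[ u ∈ N ] (⟦ off? [] W ⟧ * ⟦ free? u W ⟧))
          ≡⟨ tot-∑ N (λ u W → ⟦ off? [] W ⟧ * ⟦ free? u W ⟧) ⟩
        ∑[ u ∈ N ] tot (λ W → ⟦ off? [] W ⟧ * ⟦ free? u W ⟧)
          ≤⟨ ∑-mono N (λ u i → free≤occ (All.lookup nearby i)) ⟩
        ∑[ u ∈ N ] (2 * occ u)
          ≡⟨ ∑-*ˡ 2 N occ ⟩
        2 * ∑ N occ ∎

  -- Sum `local` over `U`. A vertex of `U` has at most `d` neighbours in `U`, so the right-hand
  -- sides total at most 2d times the sum of `occ`; that sum is `Z` times the mean size of an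
  -- independent set, hence at most `h * Z`.
  sparse-bound : ∀ {h L d} → α≤ h → (∀ v → v ∈ U → ∣ nbrs v U ∣ ≤ d) →
    (∀ x → 2 * L * suc (2 ^ x) ≤ 2 * d + 2 ^ x * x) → ∣ U ∣ * L ≤ 2 * d * h
  sparse-bound {h} {L} {d} α deg num = *-cancelʳ-≤ (∣ U ∣ * L) (2 * d * h) Z {{>-nonZero Z>0}} (begin
    ∣ U ∣ * L * Z
      ≡⟨ *-assoc ∣ U ∣ L Z ⟩
    ∣ U ∣ * (L * Z)
      ≡⟨ trans (cong (_* (L * Z)) ∣ U ∣≡∑) (trans (*-comm _ (L * Z))
           (trans (sym (∑-*ˡ (L * Z) V _)) (∑-cong V λ v _ → *-comm (L * Z) ⟦ v ∈? U ⟧))) ⟩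
    ∑[ v ∈ V ] (⟦ v ∈? U ⟧ * (L * Z))
      ≤⟨ ∑-mono V (λ v _ → ⟦⟧*-mono (v ∈? U) λ v∈U → At.local v v∈U {L} {d} num) ⟩
    ∑[ v ∈ V ] (⟦ v ∈? U ⟧ * (d * occ v + ∑ (At.nbrList v) occ))
      ≡⟨ trans (∑-cong V λ v _ → *-distribˡ-+ ⟦ v ∈? U ⟧ (d * occ v) _) (∑-+ V _ _) ⟩
    ∑[ v ∈ V ] (⟦ v ∈? U ⟧ * (d * occ v)) + ∑[ v ∈ V ] (⟦ v ∈? U ⟧ * ∑ (At.nbrList v) occ)
      ≤⟨ +-mono-≤ (∑-mono V λ v _ → ⟦⟧*-≤ (v ∈? U) λ _ → ≤-refl) degrees ⟩
    ∑[ v ∈ V ] (d * occ v) + ∑[ u ∈ V ] (d * occ u)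
      ≡⟨ cong₂ _+_ (∑-*ˡ d V occ) (∑-*ˡ d V occ) ⟩
    d * ∑ V occ + d * ∑ V occ
      ≤⟨ +-mono-≤ (*-monoʳ-≤ d occ-sum) (*-monoʳ-≤ d occ-sum) ⟩
    d * (h * Z) + d * (h * Z)
      ≡⟨ regroup d h Z ⟩
    2 * d * h * Z ∎)
    where
    open ≤-Reasoning
    V = allFin n
    Z = tot λ W → ⟦ config? W ⟧
    regroup : ∀ d h z → d * (h * z) + d * (h * z) ≡ 2 * d * h * z
    regroup = solve-∀
    Z>0 : 0 < Z
    Z>0 = tot-positive (λ W → ⟦ config? W ⟧) ⊥ (≤-reflexive (sym
      (⟦⟧-yes empty (config? ⊥))))
      where
      empty : Config ⊥
      empty = (λ i j i∈ → ⊥-elim (∉⊥ i∈)) , ⊥⊆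
    occ-sum : ∑ V occ ≤ h * Z
    occ-sum = begin
      ∑ V occ                                                   ≡⟨ sym (tot-∑ V λ u W → ⟦ u ∈? W ⟧ * ⟦ config? W ⟧) ⟩
      tot (λ W → ∑[ u ∈ V ] (⟦ u ∈? W ⟧ * ⟦ config? W ⟧))        ≤⟨ tot-mono pointwise ⟩
      tot (λ W → h * ⟦ config? W ⟧)                             ≡⟨ tot-*ˡ h (λ W → ⟦ config? W ⟧) ⟩
      h * Z                                                     ∎
      where
      pointwise : ∀ W → ∑[ u ∈ V ] (⟦ u ∈? W ⟧ * ⟦ config? W ⟧) ≤ h * ⟦ config? W ⟧
      pointwise W = begin
        ∑[ u ∈ V ] (⟦ u ∈? W ⟧ * ⟦ config? W ⟧) ≡⟨ ∑-cong V (λ u _ → *-comm ⟦ u ∈? W ⟧ ⟦ config? W ⟧) ⟩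
        ∑[ u ∈ V ] (⟦ config? W ⟧ * ⟦ u ∈? W ⟧) ≡⟨ ∑-*ˡ ⟦ config? W ⟧ V (λ u → ⟦ u ∈? W ⟧) ⟩
        ⟦ config? W ⟧ * ∑[ u ∈ V ] ⟦ u ∈? W ⟧   ≡⟨ cong (⟦ config? W ⟧ *_) (sym ∣ W ∣≡∑) ⟩
        ⟦ config? W ⟧ * ∣ W ∣                   ≤⟨ ⟦⟧*-mono (config? W) (λ (ind , _) → α W ind) ⟩
        ⟦ config? W ⟧ * h                       ≡⟨ *-comm ⟦ config? W ⟧ h ⟩
        h * ⟦ config? W ⟧                       ∎
    near? : ∀ v u → Dec (E v u × u ∈ U)
    near? v u = E? v u ×-dec (u ∈? U)
    pairs≤ : ∀ u → ∑[ v ∈ V ] (⟦ v ∈? U ⟧ * ⟦ near? v u ⟧) ≤ d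
    pairs≤ u with u ∈? U
    ... | yes u∈U = begin
      ∑[ v ∈ V ] (⟦ v ∈? U ⟧ * ⟦ E? v u ×-dec yes u∈U ⟧)
        ≤⟨ ∑-mono V (λ v _ → ⟦⟧*-≤ (v ∈? U) λ v∈U →
             ⟦⟧-mono (λ (e , _) → E-sym e , v∈U) (E? v u ×-dec yes u∈U) (near? u v)) ⟩
      ∑[ v ∈ V ] ⟦ near? u v ⟧ ≡⟨ sym (∣subset∣ (near? u)) ⟩
      ∣ nbrs u U ∣             ≤⟨ deg u u∈U ⟩
      d                        ∎
    ... | no u∉U = begin
      ∑[ v ∈ V ] (⟦ v ∈? U ⟧ * ⟦ E? v u ×-dec no u∉U ⟧)
        ≡⟨ ∑-cong V (λ v _ → trans (cong (⟦ v ∈? U ⟧ *_) (⟦⟧-no (λ (_ , p) → u∉U p) (E? v u ×-dec no u∉U)))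
                                   (*-zeroʳ ⟦ v ∈? U ⟧)) ⟩
      ∑[ v ∈ V ] 0 ≡⟨ trans (∑-const V 0) (*-zeroʳ (length V)) ⟩
      0            ≤⟨ z≤n ⟩
      d            ∎
    degrees : ∑[ v ∈ V ] (⟦ v ∈? U ⟧ * ∑ (At.nbrList v) occ) ≤ ∑[ u ∈ V ] (d * occ u)
    degrees = begin
      ∑[ v ∈ V ] (⟦ v ∈? U ⟧ * ∑ (At.nbrList v) occ)
        ≡⟨ ∑-cong V (λ v _ → trans (cong (⟦ v ∈? U ⟧ *_) (∑-filter (near? v) occ V))
                                   (sym (∑-*ˡ ⟦ v ∈? U ⟧ V λ u → ⟦ near? v u ⟧ * occ u))) ⟩
      ∑[ v ∈ V ] ∑[ u ∈ V ] (⟦ v ∈? U ⟧ * (⟦ near? v u ⟧ * occ u))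
        ≡⟨ ∑-swap V V (λ v u → ⟦ v ∈? U ⟧ * (⟦ near? v u ⟧ * occ u)) ⟩
      ∑[ u ∈ V ] ∑[ v ∈ V ] (⟦ v ∈? U ⟧ * (⟦ near? v u ⟧ * occ u))
        ≡⟨ ∑-cong V (λ u _ → trans (∑-cong V λ v _ → pull ⟦ v ∈? U ⟧ ⟦ near? v u ⟧ (occ u))
                             (trans (∑-*ˡ (occ u) V λ v → ⟦ v ∈? U ⟧ * ⟦ near? v u ⟧) (*-comm (occ u) _))) ⟩
      ∑[ u ∈ V ] (∑[ v ∈ V ] (⟦ v ∈? U ⟧ * ⟦ near? v u ⟧) * occ u)
        ≤⟨ ∑-mono V (λ u _ → *-monoˡ-≤ (occ u) (pairs≤ u)) ⟩
      ∑[ u ∈ V ] (d * occ u) ∎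
      where
      pull : ∀ a b c → a * (b * c) ≡ c * (a * b)
      pull = solve-∀

-- Peeling off neighbourhoods

∣∣-cover : ∀ (p q r s : Subset n) → (∀ i → i ∈ p → i ∈ q ⊎ i ∈ r ⊎ i ∈ s) →
  ∣ p ∣ ≤ ∣ q ∣ + (∣ r ∣ + ∣ s ∣)
∣∣-cover {n} p q r s h = begin
  ∣ p ∣                                           ≡⟨ ∣ p ∣≡∑ ⟩
  ∑ V (λ i → ⟦ i ∈? p ⟧)                          ≤⟨ ∑-mono V (λ i _ → ⟦⟧≤ (i ∈? p) (pointwise i ∘ h i)) ⟩
  ∑ V (λ i → ⟦ i ∈? q ⟧ + (⟦ i ∈? r ⟧ + ⟦ i ∈? s ⟧)) ≡⟨ trans (∑-+ V _ _) (cong (∑ V (λ i → ⟦ i ∈? q ⟧) +_) (∑-+ V _ _)) ⟩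
  ∑ V (λ i → ⟦ i ∈? q ⟧) + (∑ V (λ i → ⟦ i ∈? r ⟧) + ∑ V (λ i → ⟦ i ∈? s ⟧))
    ≡⟨ sym (cong₂ _+_ ∣ q ∣≡∑ (cong₂ _+_ ∣ r ∣≡∑ ∣ s ∣≡∑)) ⟩
  ∣ q ∣ + (∣ r ∣ + ∣ s ∣) ∎
  where
  open ≤-Reasoning
  V = allFin n
  pointwise : ∀ i → i ∈ q ⊎ i ∈ r ⊎ i ∈ s → 1 ≤ ⟦ i ∈? q ⟧ + (⟦ i ∈? r ⟧ + ⟦ i ∈? s ⟧)
  pointwise i (inj₁ m)        = m≤n⇒m≤n+o _ (≤-reflexive (sym (⟦⟧-yes m (i ∈? q))))
  pointwise i (inj₂ (inj₁ m)) = m≤n⇒m≤o+n ⟦ i ∈? q ⟧ (m≤n⇒m≤n+o _ (≤-reflexive (sym (⟦⟧-yes m (i ∈? r)))))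
  pointwise i (inj₂ (inj₂ m)) = m≤n⇒m≤o+n ⟦ i ∈? q ⟧ (m≤n⇒m≤o+n ⟦ i ∈? r ⟧ (≤-reflexive (sym (⟦⟧-yes m (i ∈? s)))))

∣∣-disjoint : ∀ (p q r : Subset n) → p ⊆ r → q ⊆ r → (∀ {i} → i ∈ p → i ∉ q) → ∣ p ∣ + ∣ q ∣ ≤ ∣ r ∣
∣∣-disjoint {n} p q r p⊆r q⊆r dis = begin
  ∣ p ∣ + ∣ q ∣                                    ≡⟨ cong₂ _+_ ∣ p ∣≡∑ ∣ q ∣≡∑ ⟩
  ∑ V (λ i → ⟦ i ∈? p ⟧) + ∑ V (λ i → ⟦ i ∈? q ⟧) ≡⟨ sym (∑-+ V _ _) ⟩
  ∑ V (λ i → ⟦ i ∈? p ⟧ + ⟦ i ∈? q ⟧)             ≤⟨ ∑-mono V (λ i _ → pointwise i) ⟩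
  ∑ V (λ i → ⟦ i ∈? r ⟧)                          ≡⟨ sym ∣ r ∣≡∑ ⟩
  ∣ r ∣ ∎
  where
  open ≤-Reasoning
  V = allFin n
  pointwise : ∀ i → ⟦ i ∈? p ⟧ + ⟦ i ∈? q ⟧ ≤ ⟦ i ∈? r ⟧
  pointwise i with i ∈? p
  ... | yes i∈p = ≤-reflexive (trans (cong suc (⟦⟧-no (dis i∈p) (i ∈? q))) (sym (⟦⟧-yes (p⊆r i∈p) (i ∈? r))))
  ... | no _    = ⟦⟧-mono q⊆r (i ∈? q) (i ∈? r)

module Spheres (G : Graph n) where
  open Graph G

  sphere₂? : ∀ v x → Dec (∃[ a ] E v a × E a x)
  sphere₂? v x = any? λ a → E? v a ×-dec E? a x

  sphere₂ : Fin n → Subset n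
  sphere₂ v = subset (sphere₂? v)

  nbrs-independent : ∀ v U → Independent (nbrs v U)
  nbrs-independent v U i j i∈ j∈ e =
    let vi , _ = ∈-subset⁻ (λ u → E? v u ×-dec (u ∈? U)) i∈
        vj , _ = ∈-subset⁻ (λ u → E? v u ×-dec (u ∈? U)) j∈
    in no-3-walk vi e (E-sym vj)

  -- Two walks of length two from `v` to the ends of an edge close up to a walk of length 5. Since
  -- walks may turn back, `sphere₂ v` contains `v` itself once `v` has a neighbour.
  sphere₂-independent : ∀ v → Independent (sphere₂ v)
  sphere₂-independent v i j i∈ j∈ e =
    let a , va , ai = ∈-subset⁻ (sphere₂? v) i∈
        b , vb , bj = ∈-subset⁻ (sphere₂? v) j∈
    in no-5-walk va ai e (E-sym bj) (E-sym vb)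

module Peeling (G : Graph n) {h : ℕ} (α : Graph.α≤_ G h) (d : ℕ) where
  open Graph G
  open Spheres G

  record Peeled (W : Subset n) : Set where
    field
      I U         : Subset n
      I⊆W         : I ⊆ W
      U⊆W         : U ⊆ W
      independent : Independent I
      separated   : ∀ {i u} → i ∈ I → u ∈ U → ¬ E i u
      sparse      : ∀ v → v ∈ U → ∣ nbrs v U ∣ ≤ d
      -- Each round removes at most 2h vertices and gains more than `d` for `I`, so |W| - |U| ≤
      -- (2h/d)|I|; this is multiplied by `d`.
      size        : d * ∣ W ∣ ≤ 2 * h * ∣ I ∣ + d * ∣ U ∣

  -- While some v has more than d neighbours left, take all of them and discard the
  -- at most h vertices at distance two from v.
  peel : ∀ k W → ∣ W ∣ ≤ k → Peeled W
  peel k W bound with any? (λ v → (v ∈? W) ×-dec (suc d ≤? ∣ nbrs v W ∣))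
  ... | no none = record
    { I = ⊥ ; U = W ; I⊆W = ⊥⊆ ; U⊆W = id
    ; independent = λ i j i∈ → ⊥-elim (∉⊥ i∈)
    ; separated = λ i∈ → ⊥-elim (∉⊥ i∈)
    ; sparse = λ v v∈ → ≮⇒≥ λ lt → none (v , v∈ , lt)
    ; size = m≤n+m _ _ }
  peel zero W bound | yes (v , v∈ , big) =
    ⊥-elim (<⇒≱ (≤-<-trans z≤n big) (≤-trans
      (p⊆q⇒∣p∣≤∣q∣ (λ i → proj₂ (∈-subset⁻ (λ u → E? v u ×-dec (u ∈? W)) i))) bound))
  peel (suc k) W bound | yes (v , v∈ , big) = record
    { I = I ∪ N₁ ; U = U
    ; I⊆W = λ i → I∪N₁⊆W (x∈p∪q⁻ I N₁ i)
    ; U⊆W = λ i → W′⊆W (U⊆W i)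
    ; independent = λ i j i∈ j∈ → ind (x∈p∪q⁻ I N₁ i∈) (x∈p∪q⁻ I N₁ j∈)
    ; separated = λ i∈ u∈ → sep (x∈p∪q⁻ I N₁ i∈) u∈
    ; sparse = sparse
    ; size = size′ }
    where
    N₁ = nbrs v W
    N₂ = sphere₂ v
    near? = λ u → E? v u ×-dec (u ∈? W)
    rest? = λ i → (i ∈? W) ×-dec ¬? (i ∈? N₁) ×-dec ¬? (i ∈? N₂)
    W′ = subset rest?
    N₁⊆W : N₁ ⊆ W
    N₁⊆W i = proj₂ (∈-subset⁻ near? i)
    W′⊆W : W′ ⊆ W
    W′⊆W i = proj₁ (∈-subset⁻ rest? i)
    W′∉N₁ : ∀ {i} → i ∈ W′ → i ∉ N₁
    W′∉N₁ i = proj₁ (proj₂ (∈-subset⁻ rest? i))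
    smaller : ∣ W′ ∣ ≤ k
    smaller = s≤s⁻¹ (begin
      suc ∣ W′ ∣      ≡⟨ +-comm 1 _ ⟩
      ∣ W′ ∣ + 1      ≤⟨ +-monoʳ-≤ ∣ W′ ∣ (≤-trans (s≤s z≤n) big) ⟩
      ∣ W′ ∣ + ∣ N₁ ∣ ≤⟨ ∣∣-disjoint W′ N₁ W W′⊆W N₁⊆W W′∉N₁ ⟩
      ∣ W ∣           ≤⟨ bound ⟩
      suc k           ∎)
      where open ≤-Reasoning
    open Peeled (peel k W′ smaller)
    I∪N₁⊆W : ∀ {i} → i ∈ I ⊎ i ∈ N₁ → i ∈ W
    I∪N₁⊆W (inj₁ i) = W′⊆W (I⊆W i)
    I∪N₁⊆W (inj₂ i) = N₁⊆W i
    -- All neighbours of `N₁`, including `v`, lie in `sphere₂ v`, which `W′` excludes.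
    apart : ∀ {i u} → i ∈ N₁ → u ∈ W′ → ¬ E i u
    apart i∈ u∈ e = proj₂ (proj₂ (∈-subset⁻ rest? u∈))
      (∈-subset⁺ (sphere₂? v) (_ , proj₁ (∈-subset⁻ near? i∈) , e))
    ind : ∀ {i j} → i ∈ I ⊎ i ∈ N₁ → j ∈ I ⊎ j ∈ N₁ → ¬ E i j
    ind (inj₁ p) (inj₁ q) = independent _ _ p q
    ind (inj₁ p) (inj₂ q) = λ e → apart q (I⊆W p) (E-sym e)
    ind (inj₂ p) (inj₁ q) = apart p (I⊆W q)
    ind (inj₂ p) (inj₂ q) = nbrs-independent v W _ _ p q
    sep : ∀ {i u} → i ∈ I ⊎ i ∈ N₁ → u ∈ U → ¬ E i u
    sep (inj₁ p) q = separated p q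
    sep (inj₂ p) q = apart p (U⊆W q)
    cover : ∀ i → i ∈ W → i ∈ W′ ⊎ i ∈ N₁ ⊎ i ∈ N₂
    cover i i∈ with i ∈? N₁ | i ∈? N₂
    ... | yes p | _     = inj₂ (inj₁ p)
    ... | no _  | yes q = inj₂ (inj₂ q)
    ... | no p  | no q  = inj₁ (∈-subset⁺ rest? (i∈ , p , q))
    size′ : d * ∣ W ∣ ≤ 2 * h * ∣ I ∪ N₁ ∣ + d * ∣ U ∣
    size′ = begin
      d * ∣ W ∣
        ≤⟨ *-monoʳ-≤ d (∣∣-cover W W′ N₁ N₂ cover) ⟩
      d * (∣ W′ ∣ + (∣ N₁ ∣ + ∣ N₂ ∣))
        ≤⟨ *-monoʳ-≤ d (+-monoʳ-≤ ∣ W′ ∣ (+-mono-≤ (α N₁ (nbrs-independent v W)) (α N₂ (sphere₂-independent v)))) ⟩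
      d * (∣ W′ ∣ + (h + h))
        ≡⟨ expand d (∣ W′ ∣) h ⟩
      d * ∣ W′ ∣ + 2 * h * d
        ≤⟨ +-mono-≤ size (*-monoʳ-≤ (2 * h) (≤-trans (n≤1+n d) big)) ⟩
      2 * h * ∣ I ∣ + d * ∣ U ∣ + 2 * h * ∣ N₁ ∣
        ≡⟨ collect (2 * h) (∣ I ∣) (d * ∣ U ∣) (∣ N₁ ∣) ⟩
      2 * h * (∣ I ∣ + ∣ N₁ ∣) + d * ∣ U ∣
        ≤⟨ +-monoˡ-≤ (d * ∣ U ∣) (*-monoʳ-≤ (2 * h) (∣∣-disjoint I N₁ (I ∪ N₁)
             (λ i → x∈p∪q⁺ (inj₁ i)) (λ i → x∈p∪q⁺ (inj₂ i)) (λ i → W′∉N₁ (I⊆W i)))) ⟩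
      2 * h * ∣ I ∪ N₁ ∣ + d * ∣ U ∣ ∎
      where
      open ≤-Reasoning
      expand : ∀ d w h → d * (w + (h + h)) ≡ d * w + 2 * h * d
      expand = solve-∀
      collect : ∀ a i u m → a * i + u + a * m ≡ a * (i + m) + u
      collect = solve-∀

-- Choice of the degree threshold and the bound on the independence number

m<2^m : ∀ m → m < 2 ^ m
m<2^m zero    = s≤s z≤n
m<2^m (suc m) = ≤-trans (+-mono-≤ (m^n>0 2 m) (m<2^m m)) (≤-reflexive (cong (2 ^ m +_) (sym (+-identityʳ _))))

-- Supplies the numerical condition of `local` with `L` of order log d. For x ≤ 2L the term `2 * d`
-- pays, as L(1 + 2^x) ≤ 2^L·2·2^(2L); for larger `x` the term `2 ^ x * x` does.
2^-dominates : ∀ {L d} → 2 ^ suc (3 * L) ≤ d → ∀ x → 2 * L * suc (2 ^ x) ≤ 2 * d + 2 ^ x * x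
2^-dominates {L} {d} big x with x ≤? 2 * L
... | yes x≤ = begin
  2 * L * suc (2 ^ x)              ≤⟨ *-monoʳ-≤ (2 * L) (+-monoˡ-≤ (2 ^ x) (m^n>0 2 x)) ⟩
  2 * L * (2 ^ x + 2 ^ x)          ≤⟨ *-mono-≤ (*-monoʳ-≤ 2 (<⇒≤ (m<2^m L))) (+-mono-≤ 2^x≤ 2^x≤) ⟩
  2 * 2 ^ L * (2 ^ (2 * L) + 2 ^ (2 * L)) ≡⟨ regroup (2 ^ L) (2 ^ (2 * L)) ⟩
  2 * (2 * (2 ^ L * 2 ^ (2 * L)))  ≡⟨ cong (λ e → 2 * (2 * e)) (sym (^-distribˡ-+-* 2 L (2 * L))) ⟩
  2 * 2 ^ suc (3 * L)              ≤⟨ *-monoʳ-≤ 2 big ⟩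
  2 * d                            ≤⟨ m≤m+n _ _ ⟩
  2 * d + 2 ^ x * x                ∎
  where
  open ≤-Reasoning
  2^x≤ = ^-monoʳ-≤ 2 x≤
  regroup : ∀ a b → 2 * a * (b + b) ≡ 2 * (2 * (a * b))
  regroup = solve-∀
... | no x≰ = begin
  2 * L * suc (2 ^ x)     ≡⟨ *-suc (2 * L) (2 ^ x) ⟩
  2 * L + 2 * L * 2 ^ x   ≤⟨ +-monoˡ-≤ _ (<⇒≤ (<-trans (≰⇒> x≰) (m<2^m x))) ⟩
  2 ^ x + 2 * L * 2 ^ x   ≡⟨ *-comm (suc (2 * L)) (2 ^ x) ⟩
  2 ^ x * suc (2 * L)     ≤⟨ *-monoʳ-≤ (2 ^ x) (≰⇒> x≰) ⟩
  2 ^ x * x               ≤⟨ m≤n+m _ _ ⟩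
  2 * d + 2 ^ x * x       ∎
  where
  open ≤-Reasoning

-- The peeling loses at most half of the vertices as soon as 4h² ≤ dn.
α-bound : (G : Graph n) → ∀ {h L} → Graph.α≤_ G h → 1 ≤ L → 2 ^ (9 * L + 7) ≤ n →
  n * n * L ≤ 32 * (h * h * h)
α-bound {n} G {h} {L} α L≥1 n-big = finish
  where
  open ≤-Reasoning
  n>0 : 0 < n
  n>0 = <-≤-trans (m^n>0 2 (9 * L + 7)) n-big
  instance
    n≢0 : NonZero n
    n≢0 = >-nonZero n>0
  -- `D` is the smallest degree bound that `2^-dominates` admits. Adding `q` ensures nd ≥ 4h², so
  -- that half of the vertices survive the peeling; `D` also absorbs the rounding in `q`.
  D = 2 ^ suc (3 * L)
  q = 4 * (h * h) / n
  d = q + D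
  instance
    d≢0 : NonZero d
    d≢0 = >-nonZero (<-≤-trans (m^n>0 2 (suc (3 * L))) (m≤n+m D q))
    D≢0 : NonZero D
    D≢0 = >-nonZero (m^n>0 2 (suc (3 * L)))
  open Peeling.Peeled (Peeling.peel G α d n ⊤ (≤-reflexive (∣⊤∣≡n n)))
  4h²≤nd : 4 * (h * h) ≤ n * d
  4h²≤nd = begin
    4 * (h * h)                        ≡⟨ m≡m%n+[m/n]*n (4 * (h * h)) n ⟩
    4 * (h * h) % n + q * n ≤⟨ +-monoˡ-≤ (q * n) (<⇒≤ (m%n<n (4 * (h * h)) n)) ⟩
    n + q * n                          ≡⟨ *-comm (suc q) n ⟩
    n * suc q                          ≤⟨ *-monoʳ-≤ n (≤-trans (≤-reflexive (+-comm 1 q)) (+-monoʳ-≤ q (m^n>0 2 (suc (3 * L))))) ⟩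
    n * d                              ∎
  nd≤ : n * d ≤ 4 * (h * h) + D * n
  nd≤ = begin
    n * (q + D)       ≡⟨ *-distribˡ-+ n q D ⟩
    n * q + n * D     ≡⟨ cong₂ _+_ (*-comm n q) (*-comm n D) ⟩
    q * n + D * n     ≤⟨ +-monoˡ-≤ (D * n) (≤-trans (m≤n+m (q * n) _) (≤-reflexive (sym (m≡m%n+[m/n]*n (4 * (h * h)) n)))) ⟩
    4 * (h * h) + D * n ∎
  peeled : d * n ≤ 2 * (h * h) + d * ∣ U ∣
  peeled = begin
    d * n                       ≡⟨ cong (d *_) (sym (∣⊤∣≡n n)) ⟩
    d * ∣ ⊤ {n} ∣               ≤⟨ size ⟩
    2 * h * ∣ I ∣ + d * ∣ U ∣   ≤⟨ +-monoˡ-≤ _ (*-monoʳ-≤ (2 * h) (α I independent)) ⟩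
    2 * h * h + d * ∣ U ∣       ≡⟨ cong (_+ d * ∣ U ∣) (*-assoc 2 h h) ⟩
    2 * (h * h) + d * ∣ U ∣     ∎
  -- Combines |U| ≥ n/2 with |U|L ≤ 2dh. The term ndL is carried on both sides to avoid truncated
  -- subtraction.
  nL≤4dh : n * L ≤ 4 * (d * h)
  nL≤4dh = *-cancelˡ-≤ d (+-cancelˡ-≤ (n * d * L) _ _ (begin
    n * d * L + d * (n * L)                 ≡⟨ e₁ n d L ⟩
    2 * (d * n) * L                         ≤⟨ *-monoˡ-≤ L (*-monoʳ-≤ 2 peeled) ⟩
    2 * (2 * (h * h) + d * ∣ U ∣) * L       ≡⟨ e₂ h d (∣ U ∣) L ⟩
    4 * (h * h) * L + 2 * d * (∣ U ∣ * L)   ≤⟨ +-mono-≤ (*-monoˡ-≤ L 4h²≤nd) (*-monoʳ-≤ (2 * d)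
                                                (HardCore.sparse-bound G U {h} {L} {d} α sparse (2^-dominates {L} (m≤n+m D q)))) ⟩
    n * d * L + 2 * d * (2 * d * h)         ≡⟨ e₃ n d L h ⟩
    n * d * L + d * (4 * (d * h))           ∎))
    where
    e₁ : ∀ n d L → n * d * L + d * (n * L) ≡ 2 * (d * n) * L
    e₁ = solve-∀
    e₂ : ∀ h d u L → 2 * (2 * (h * h) + d * u) * L ≡ 4 * (h * h) * L + 2 * d * (u * L)
    e₂ = solve-∀
    e₃ : ∀ n d L h → n * d * L + 2 * d * (2 * d * h) ≡ n * d * L + d * (4 * (d * h))
    e₃ = solve-∀
  n²L≤ : n * n * L ≤ 4 * ((4 * (h * h) + D * n) * h)
  n²L≤ = begin
    n * n * L                         ≡⟨ *-assoc n n L ⟩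
    n * (n * L)                       ≤⟨ *-monoʳ-≤ n nL≤4dh ⟩
    n * (4 * (d * h))                 ≡⟨ e n d h ⟩
    4 * (n * d * h)                   ≤⟨ *-monoʳ-≤ 4 (*-monoˡ-≤ h nd≤) ⟩
    4 * ((4 * (h * h) + D * n) * h)   ∎
    where
    e : ∀ n d h → n * (4 * (d * h)) ≡ 4 * (n * d * h)
    e = solve-∀
  -- This fixes the exponent in the hypothesis on `n`: 3(3L + 1) + 4 = 9L + 7.
  16D³≤n : 16 * (D * D * D) ≤ n
  16D³≤n = begin
    16 * (D * D * D)       ≡⟨ cong (16 *_) (trans (cong (_* D) (sym (^-distribˡ-+-* 2 k k))) (sym (^-distribˡ-+-* 2 (k + k) k))) ⟩
    2 ^ 4 * 2 ^ (k + k + k) ≡⟨ sym (^-distribˡ-+-* 2 4 (k + k + k)) ⟩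
    2 ^ (4 + (k + k + k))  ≡⟨ cong (2 ^_) (e L) ⟩
    2 ^ (9 * L + 7)        ≤⟨ n-big ⟩
    n                      ∎
    where
    k = suc (3 * L)
    e : ∀ L → 4 + (suc (3 * L) + suc (3 * L) + suc (3 * L)) ≡ 9 * L + 7
    e = solve-∀
  finish : n * n * L ≤ 32 * (h * h * h)
  finish with D * n ≤? 4 * (h * h)
  ... | yes small = begin
    n * n * L                                   ≤⟨ n²L≤ ⟩
    4 * ((4 * (h * h) + D * n) * h)             ≤⟨ *-monoʳ-≤ 4 (*-monoˡ-≤ h (+-monoʳ-≤ (4 * (h * h)) small)) ⟩
    4 * ((4 * (h * h) + 4 * (h * h)) * h)       ≡⟨ e h ⟩
    32 * (h * h * h)                            ∎
    where
    e : ∀ h → 4 * ((4 * (h * h) + 4 * (h * h)) * h) ≡ 32 * (h * h * h)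
    e = solve-∀
  -- `D` cannot be the larger part of `d`: n ≤ 8Dh and 4h² < Dn would give n² < 16D³n ≤ n².
  ... | no ¬small = ⊥-elim (<-irrefl refl (begin-strict
    n * n                            ≤⟨ *-mono-≤ n≤8Dh n≤8Dh ⟩
    8 * D * h * (8 * D * h)          ≡⟨ e₂ D h ⟩
    16 * (D * D) * (4 * (h * h))     <⟨ *-monoʳ-< (16 * (D * D)) {{m*n≢0 16 (D * D) {{_}} {{m*n≢0 D D}}}} (≰⇒> ¬small) ⟩
    16 * (D * D) * (D * n)           ≡⟨ e₃ D n ⟩
    16 * (D * D * D) * n             ≤⟨ *-monoˡ-≤ n 16D³≤n ⟩
    n * n                            ∎))
    where
    e₁ : ∀ D n h → 4 * ((D * n + D * n) * h) ≡ n * (8 * D * h)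
    e₁ = solve-∀
    e₂ : ∀ D h → 8 * D * h * (8 * D * h) ≡ 16 * (D * D) * (4 * (h * h))
    e₂ = solve-∀
    e₃ : ∀ D n → 16 * (D * D) * (D * n) ≡ 16 * (D * D * D) * n
    e₃ = solve-∀
    n≤8Dh : n ≤ 8 * D * h
    n≤8Dh = *-cancelˡ-≤ n (begin
      n * n                                 ≡⟨ sym (*-identityʳ (n * n)) ⟩
      n * n * 1                             ≤⟨ *-monoʳ-≤ (n * n) L≥1 ⟩
      n * n * L                             ≤⟨ n²L≤ ⟩
      4 * ((4 * (h * h) + D * n) * h)       ≤⟨ *-monoʳ-≤ 4 (*-monoˡ-≤ h (+-monoˡ-≤ (D * n) (<⇒≤ (≰⇒> ¬small)))) ⟩
      4 * ((D * n + D * n) * h)             ≡⟨ e₁ D n h ⟩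
      n * (8 * D * h)                       ∎)

-- Random edge sets avoiding forbidden configurations

-- A graph with edge set g ⊆ Fin N has weight M^-∣g∣ up to normalisation.  A link of
-- an edge a is what is left of a forbidden configuration when a is removed from it.
module RandomGood
  (M : ℕ) {{_ : NonZero M}} {N : ℕ}
  (Good : Subset N → Set) (good? : ∀ g → Dec (Good g))
  (good-⊥ : Good ⊥) (good-⊕⁻ : ∀ g a → Good (g ⊕ a) → Good g)
  (links : Fin N → List (List (Fin N)))
  (links-unique : ∀ a A → A ∈ˡ links a → Unique A)
  (links-short : ∀ a A → A ∈ˡ links a → length A ≤ 4)
  (links-weight : ∀ a → 2 * ∑[ A ∈ links a ] (M ^ (4 ∸ length A)) ≤ M ^ 4)
  (good-⊕ : ∀ g a → Good g → a ∉ g → (∀ A → A ∈ˡ links a → ¬ All (_∈ g) A) → Good (g ⊕ a))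
  where

  open Weighted M

  module _ {Q : Subset N → Set} (Q? : ∀ g → Dec (Q g)) (Q-⊕⁻ : ∀ g a → Q (g ⊕ a) → Q g) where

    abstract
      containing? : ∀ A g → Dec (All (_∈ g) A × Q g)
      containing? A g = All.all? (_∈? g) A ×-dec Q? g

    -- `Q` survives deletions, so the elements of `A` can be deleted one by one, each deletion being
    -- an injection that gains a factor `M`. Distinctness keeps the rest of `A` in place when `a`
    -- goes.
    tot-containing : ∀ A → Unique A → M ^ length A * tot (λ g → ⟦ containing? A g ⟧) ≤ tot (λ g → ⟦ Q? g ⟧)
    tot-containing []      _               = ≤-trans (≤-reflexive (*-identityˡ _))
      (tot-mono λ g → ⟦⟧-mono proj₂ (containing? [] g) (Q? g))
    tot-containing (a ∷ A) (a∉A ∷ unique) = begin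
      M * M ^ length A * tot (λ g → ⟦ containing? (a ∷ A) g ⟧)
        ≡⟨ shuffle M (M ^ length A) _ ⟩
      M ^ length A * (M * tot (λ g → ⟦ containing? (a ∷ A) g ⟧))
        ≡⟨ cong (λ x → M ^ length A * (M * x)) (tot-cong split) ⟩
      M ^ length A * (M * tot (λ g → ⟦ a ∈? g ⟧ * ⟦ containing? A g ⟧))
        ≡⟨ cong (M ^ length A *_) (toggle a (λ g → ⟦ containing? A g ⟧)) ⟩
      M ^ length A * tot (λ g → ⟦ ¬? (a ∈? g) ⟧ * ⟦ containing? A (g ⊕ a) ⟧)
        ≤⟨ *-monoʳ-≤ (M ^ length A) (tot-mono λ g → ⟦⟧*-≤ (¬? (a ∈? g)) λ _ →
             ⟦⟧-mono (down g) (containing? A (g ⊕ a)) (containing? A g)) ⟩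
      M ^ length A * tot (λ g → ⟦ containing? A g ⟧)
        ≤⟨ tot-containing A unique ⟩
      tot (λ g → ⟦ Q? g ⟧) ∎
      where
      open ≤-Reasoning
      shuffle : ∀ m k x → m * k * x ≡ k * (m * x)
      shuffle = solve-∀
      split : ∀ g → ⟦ containing? (a ∷ A) g ⟧ ≡ ⟦ a ∈? g ⟧ * ⟦ containing? A g ⟧
      split g with a ∈? g
      ... | yes a∈ = trans (⟦⟧-cong (λ { (_ ∷ A⊆ , q) → A⊆ , q }) (λ (A⊆ , q) → a∈ ∷ A⊆ , q)
                              (containing? (a ∷ A) g) (containing? A g)) (sym (+-identityʳ _))
      ... | no a∉  = ⟦⟧-no (λ { (a∈ ∷ _ , _) → a∉ a∈ }) (containing? (a ∷ A) g)
      old : ∀ g {x} → a ≢ x → x ∈ g ⊕ a → x ∈ g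
      old g a≢x i with ∈-⊕⁻ g i
      ... | inj₁ refl = ⊥-elim (a≢x refl)
      ... | inj₂ p    = p
      down : ∀ g → All (_∈ g ⊕ a) A × Q (g ⊕ a) → All (_∈ g) A × Q g
      down g (A⊆ , q) = All.zipWith (λ (a≢x , i) → old g a≢x i) (a∉A , A⊆) , Q-⊕⁻ g a q

  Missing : List (Fin N) → Subset N → Set
  Missing T g = Good g × All (_∉ g) T

  abstract
    missing? : ∀ T g → Dec (Missing T g)
    missing? T g = good? g ×-dec All.all? (λ a → ¬? (a ∈? g)) T

  missing-⊕⁻ : ∀ T g a → Missing T (g ⊕ a) → Missing T g
  missing-⊕⁻ T g a (good , T∉) = good-⊕⁻ g a good , All.map (λ t∉ i → t∉ (⊆-⊕ g i)) T∉

  weight : List (Fin N) → ℕ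
  weight T = tot λ g → ⟦ missing? T g ⟧

  -- By `tot-containing` and a union bound over the links, at most half of the weight of `a ∷ T` has
  -- a complete link of `a`. On the other half `a` can be added at the cost of a factor `M`, so the
  -- sets missing `T` but containing `a` weigh at least 1/(2M) of those missing both.
  weight-∷ : ∀ {a T} → All (a ≢_) T → suc (2 * M) * weight (a ∷ T) ≤ 2 * M * weight T
  weight-∷ {a} {T} a∉T = begin
    suc (2 * M) * w             ≡⟨ +-comm w (2 * M * w) ⟩
    2 * M * w + w               ≤⟨ +-monoʳ-≤ (2 * M * w) w≤2w′ ⟩
    2 * M * w + 2 * w′           ≡⟨ cong (λ y → 2 * M * w + 2 * y) (sym (toggle a (λ g → ⟦ missing? T g ⟧))) ⟩
    2 * M * w + 2 * (M * w₁)    ≡⟨ collect M w w₁ ⟩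
    2 * M * (w₁ + w)            ≡⟨ cong (2 * M *_) (sym (trans (tot-split a (λ g → ⟦ missing? T g ⟧))
                                     (cong (w₁ +_) (tot-cong split)))) ⟩
    2 * M * weight T            ∎
    where
    open ≤-Reasoning
    w = weight (a ∷ T)
    w₁ = tot λ g → ⟦ a ∈? g ⟧ * ⟦ missing? T g ⟧
    w′ = tot λ g → ⟦ ¬? (a ∈? g) ⟧ * ⟦ missing? T (g ⊕ a) ⟧
    collect : ∀ m x y → 2 * m * x + 2 * (m * y) ≡ 2 * m * (y + x)
    collect = solve-∀
    split : ∀ g → ⟦ ¬? (a ∈? g) ⟧ * ⟦ missing? T g ⟧ ≡ ⟦ missing? (a ∷ T) g ⟧
    split g with a ∈? g
    ... | yes a∈ = sym (⟦⟧-no (λ { (_ , a∉ ∷ _) → a∉ a∈ }) (missing? (a ∷ T) g))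
    ... | no a∉  = trans (+-identityʳ _) (⟦⟧-cong (λ (good , T∉) → good , a∉ ∷ T∉)
                     (λ { (good , _ ∷ T∉) → good , T∉ }) (missing? T g) (missing? (a ∷ T) g))
    blocked? = containing? (missing? (a ∷ T)) (missing-⊕⁻ (a ∷ T))
    B = ∑[ A ∈ links a ] tot (λ g → ⟦ blocked? A g ⟧)
    2B≤w : 2 * B ≤ w
    2B≤w = *-cancelˡ-≤ (M ^ 4) {{m^n≢0 M 4}} (begin
      M ^ 4 * (2 * B)
        ≡⟨ shuffle (M ^ 4) B ⟩
      2 * (M ^ 4 * B)
        ≡⟨ cong (2 *_) (sym (∑-*ˡ (M ^ 4) (links a) _)) ⟩
      2 * ∑[ A ∈ links a ] (M ^ 4 * tot (λ g → ⟦ blocked? A g ⟧))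
        ≤⟨ *-monoʳ-≤ 2 (∑-mono (links a) λ A i → one A i) ⟩
      2 * ∑[ A ∈ links a ] (w * M ^ (4 ∸ length A))
        ≡⟨ trans (cong (2 *_) (∑-*ˡ w (links a) _)) (sym (shuffle w _)) ⟩
      w * (2 * ∑[ A ∈ links a ] (M ^ (4 ∸ length A)))
        ≤⟨ *-monoʳ-≤ w (links-weight a) ⟩
      w * M ^ 4
        ≡⟨ *-comm w (M ^ 4) ⟩
      M ^ 4 * w ∎)
      where
      shuffle : ∀ m b → m * (2 * b) ≡ 2 * (m * b)
      shuffle = solve-∀
      one : ∀ A → A ∈ˡ links a → M ^ 4 * tot (λ g → ⟦ blocked? A g ⟧) ≤ w * M ^ (4 ∸ length A)
      one A i = begin
        M ^ 4 * tot (λ g → ⟦ blocked? A g ⟧)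
          ≡⟨ cong (_* tot (λ g → ⟦ blocked? A g ⟧)) (trans (cong (M ^_) (sym (m∸n+n≡m (links-short a A i))))
               (^-distribˡ-+-* M (4 ∸ length A) (length A))) ⟩
        M ^ (4 ∸ length A) * M ^ length A * tot (λ g → ⟦ blocked? A g ⟧)
          ≡⟨ *-assoc (M ^ (4 ∸ length A)) (M ^ length A) _ ⟩
        M ^ (4 ∸ length A) * (M ^ length A * tot (λ g → ⟦ blocked? A g ⟧))
          ≤⟨ *-monoʳ-≤ (M ^ (4 ∸ length A)) (tot-containing (missing? (a ∷ T)) (missing-⊕⁻ (a ∷ T)) A (links-unique a A i)) ⟩
        M ^ (4 ∸ length A) * w
          ≡⟨ *-comm (M ^ (4 ∸ length A)) w ⟩
        w * M ^ (4 ∸ length A) ∎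
    off : ∀ g {x} → a ≢ x → x ∉ g → x ∉ g ⊕ a
    off g a≢x x∉ i with ∈-⊕⁻ g i
    ... | inj₁ refl = a≢x refl
    ... | inj₂ p    = x∉ p
    pointwise : ∀ g → Missing (a ∷ T) g → 1 ≤
      ⟦ ¬? (a ∈? g) ⟧ * ⟦ missing? T (g ⊕ a) ⟧ + ∑[ A ∈ links a ] ⟦ blocked? A g ⟧
    pointwise g mis@(good , a∉ ∷ T∉) with Any.any? (All.all? (_∈? g)) (links a)
    ... | yes found = let A , i , A⊆ = findˡ found in
      m≤n⇒m≤o+n (⟦ ¬? (a ∈? g) ⟧ * ⟦ missing? T (g ⊕ a) ⟧)
        (≤-trans (≤-reflexive (sym (⟦⟧-yes (A⊆ , mis) (blocked? A g)))) (∈⇒≤∑ (λ A → ⟦ blocked? A g ⟧) i))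
    ... | no none = m≤n⇒m≤n+o _ (≤-reflexive (sym (cong₂ _*_ (⟦⟧-yes a∉ (¬? (a ∈? g)))
        (⟦⟧-yes (good-⊕ g a good a∉ (λ A i A⊆ → none (loseˡ i A⊆)) ,
                 All.zipWith (λ (a≢t , t∉) → off g a≢t t∉) (a∉T , T∉)) (missing? T (g ⊕ a))))))
    w≤w′+B : w ≤ w′ + B
    w≤w′+B = begin
      w
        ≤⟨ tot-mono (λ g → ⟦⟧≤ (missing? (a ∷ T) g) (pointwise g)) ⟩
      tot (λ g → ⟦ ¬? (a ∈? g) ⟧ * ⟦ missing? T (g ⊕ a) ⟧ + ∑[ A ∈ links a ] ⟦ blocked? A g ⟧)
        ≡⟨ trans (tot-+ (λ g → ⟦ ¬? (a ∈? g) ⟧ * ⟦ missing? T (g ⊕ a) ⟧) (λ g → ∑[ A ∈ links a ] ⟦ blocked? A g ⟧))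
             (cong (w′ +_) (tot-∑ (links a) λ A g → ⟦ blocked? A g ⟧)) ⟩
      w′ + B ∎
    w≤2w′ : w ≤ 2 * w′
    w≤2w′ = +-cancelˡ-≤ w w (2 * w′) (begin
      w + w             ≡⟨ cong (w +_) (sym (+-identityʳ w)) ⟩
      2 * w             ≤⟨ *-monoʳ-≤ 2 w≤w′+B ⟩
      2 * (w′ + B)       ≡⟨ trans (*-distribˡ-+ 2 w′ B) (+-comm (2 * w′) (2 * B)) ⟩
      2 * B + 2 * w′     ≤⟨ +-monoˡ-≤ (2 * w′) 2B≤w ⟩
      w + 2 * w′         ∎)

  -- Iterating `weight-∷`, a random good set misses `T` with probability at most (1 + 1/2M)^-|T|.
  weight-bound : ∀ T → Unique T → suc (2 * M) ^ length T * weight T ≤ (2 * M) ^ length T * weight []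
  weight-bound []      _            = ≤-refl
  weight-bound (a ∷ T) (a∉T ∷ uniq) = begin
    suc (2 * M) * suc (2 * M) ^ length T * weight (a ∷ T)
      ≡⟨ shuffle (suc (2 * M)) (suc (2 * M) ^ length T) (weight (a ∷ T)) ⟩
    suc (2 * M) ^ length T * (suc (2 * M) * weight (a ∷ T))
      ≤⟨ *-monoʳ-≤ (suc (2 * M) ^ length T) (weight-∷ a∉T) ⟩
    suc (2 * M) ^ length T * (2 * M * weight T)
      ≡⟨ sym (shuffle (2 * M) (suc (2 * M) ^ length T) (weight T)) ⟩
    2 * M * suc (2 * M) ^ length T * weight T
      ≡⟨ *-assoc (2 * M) _ _ ⟩
    2 * M * (suc (2 * M) ^ length T * weight T)
      ≤⟨ *-monoʳ-≤ (2 * M) (weight-bound T uniq) ⟩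
    2 * M * ((2 * M) ^ length T * weight [])
      ≡⟨ sym (*-assoc (2 * M) _ _) ⟩
    2 * M * (2 * M) ^ length T * weight [] ∎
    where
    open ≤-Reasoning
    shuffle : ∀ m k x → m * k * x ≡ k * (m * x)
    shuffle = solve-∀

  -- The expected number of missed members of `𝒯` is below 1. `tot-<-exists` then gives a `g` whose
  -- number of missed members is strictly below an indicator of goodness, so `g` is good and misses
  -- none.
  transversal : ∀ t (𝒯 : List (List (Fin N))) → (∀ T → T ∈ˡ 𝒯 → Unique T × length T ≡ t) →
    length 𝒯 * (2 * M) ^ t < suc (2 * M) ^ t →
    ∃[ g ] Good g × (∀ T → T ∈ˡ 𝒯 → ¬ All (_∉ g) T)
  transversal t 𝒯 ok count = g , good , λ T i T∉ → <⇒≱ lt (begin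
    ⟦ missing? [] g ⟧              ≤⟨ ⟦⟧≤1 (missing? [] g) ⟩
    1                              ≡⟨ sym (⟦⟧-yes (good , T∉) (missing? T g)) ⟩
    ⟦ missing? T g ⟧               ≤⟨ ∈⇒≤∑ (λ T → ⟦ missing? T g ⟧) i ⟩
    ∑[ T ∈ 𝒯 ] ⟦ missing? T g ⟧    ∎)
    where
    open ≤-Reasoning
    a = suc (2 * M) ^ t
    instance
      a≢0 : NonZero a
      a≢0 = m^n≢0 (suc (2 * M)) t
      w≢0 : NonZero (weight [])
      w≢0 = >-nonZero (tot-positive (λ g → ⟦ missing? [] g ⟧) ⊥
        (≤-reflexive (sym (⟦⟧-yes (good-⊥ , []) (missing? [] ⊥)))))
    few : ∑ 𝒯 weight < weight []
    few = *-cancelˡ-< a (∑ 𝒯 weight) (weight []) (begin-strict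
      a * ∑ 𝒯 weight                       ≡⟨ sym (∑-*ˡ a 𝒯 weight) ⟩
      ∑[ T ∈ 𝒯 ] (a * weight T)            ≤⟨ ∑-bound 𝒯 (λ T i → each T (ok T i)) ⟩
      length 𝒯 * ((2 * M) ^ t * weight []) ≡⟨ sym (*-assoc (length 𝒯) _ _) ⟩
      length 𝒯 * (2 * M) ^ t * weight []   <⟨ *-monoˡ-< (weight []) count ⟩
      a * weight []                        ∎)
      where
      each : ∀ T → Unique T × length T ≡ t → a * weight T ≤ (2 * M) ^ t * weight []
      each T (uniq , refl) = weight-bound T uniq
    found : ∃[ g ] ∑[ T ∈ 𝒯 ] ⟦ missing? T g ⟧ < ⟦ missing? [] g ⟧
    found = tot-<-exists (λ g → ∑[ T ∈ 𝒯 ] ⟦ missing? T g ⟧) (λ g → ⟦ missing? [] g ⟧)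
      (≤-<-trans (≤-reflexive (tot-∑ 𝒯 λ T g → ⟦ missing? T g ⟧)) few)
    g = proj₁ found
    lt = proj₂ found
    good : Good g
    good with missing? [] g | lt
    ... | yes (good , _) | _ = good
    ... | no _           | ()

-- Random graphs without triangles and pentagons

length-cartesianProductWith : ∀ {A B C : Set} (f : A → B → C) xs ys →
  length (cartesianProductWith f xs ys) ≡ length xs * length ys
length-cartesianProductWith f []       ys = refl
length-cartesianProductWith f (x ∷ xs) ys = trans (Listₚ.length-++ (map (f x) ys))
  (cong₂ _+_ (Listₚ.length-map (f x) ys) (length-cartesianProductWith f xs ys))

∑-++ : ∀ {X : Set} (xs ys : List X) (f : X → ℕ) → ∑ (xs ++ ys) f ≡ ∑ xs f + ∑ ys f
∑-++ xs ys f = trans (cong sum (Listₚ.map-++ f xs ys)) (sum-++ (map f xs) (map f ys))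

∑-map : ∀ {X Y : Set} (g : X → Y) (xs : List X) (f : Y → ℕ) → ∑ (map g xs) f ≡ ∑ xs (f ∘ g)
∑-map g xs f = cong sum (sym (Listₚ.map-∘ xs))

length-allFin : ∀ n → length (allFin n) ≡ n
length-allFin n = Listₚ.length-tabulate {n = n} id

abstract
  edge : Fin n → Fin n → Fin (n * n)
  edge i j with i Finₚ.≤? j
  ... | yes _ = combine i j
  ... | no _  = combine j i

  edge-sym : ∀ (i j : Fin n) → edge i j ≡ edge j i
  edge-sym i j with i Finₚ.≤? j | j Finₚ.≤? i
  ... | yes p | yes q = cong₂ combine (Finₚ.≤-antisym p q) (Finₚ.≤-antisym q p)
  ... | yes _ | no _  = refl
  ... | no _  | yes _ = refl
  ... | no p  | no q  with Finₚ.≤-total i j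
  ...   | inj₁ r = ⊥-elim (p r)
  ...   | inj₂ r = ⊥-elim (q r)

  ends : Fin (n * n) → Fin n × Fin n
  ends {n} = remQuot n

  ends-edge : ∀ (i j : Fin n) → ends (edge i j) ≡ (i , j) ⊎ ends (edge i j) ≡ (j , i)
  ends-edge i j with i Finₚ.≤? j
  ... | yes _ = inj₁ (remQuot-combine i j)
  ... | no _  = inj₂ (remQuot-combine j i)

  edge-injective : ∀ (i j k l : Fin n) → edge i j ≡ edge k l → (i ≡ k × j ≡ l) ⊎ (i ≡ l × j ≡ k)
  edge-injective i j k l eq with i Finₚ.≤? j | k Finₚ.≤? l
  ... | yes _ | yes _ = inj₁ (combine-injective i j k l eq)
  ... | yes _ | no _  = inj₂ (combine-injective i j l k eq)
  ... | no _  | yes _ = let p , q = combine-injective j i k l eq in inj₂ (q , p)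
  ... | no _  | no _  = let p , q = combine-injective j i l k eq in inj₁ (q , p)

edge-≢ˡ : ∀ {a b c d : Fin n} → a ≢ c → a ≢ d → edge a b ≢ edge c d
edge-≢ˡ a≢c a≢d eq with edge-injective _ _ _ _ eq
... | inj₁ (a≡c , _) = a≢c a≡c
... | inj₂ (a≡d , _) = a≢d a≡d

edge-≢ʳ : ∀ {a b c d : Fin n} → b ≢ c → b ≢ d → edge a b ≢ edge c d
edge-≢ʳ b≢c b≢d eq with edge-injective _ _ _ _ eq
... | inj₁ (_ , b≡d) = b≢d b≡d
... | inj₂ (_ , b≡c) = b≢c b≡c

edge-injectiveʳ : ∀ {a b c : Fin n} → edge a b ≡ edge a c → b ≡ c
edge-injectiveʳ eq with edge-injective _ _ _ _ eq
... | inj₁ (_ , b≡c)     = b≡c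
... | inj₂ (refl , refl) = refl

pairs : List (Fin n) → List (Fin (n * n))
pairs []       = []
pairs (x ∷ xs) = map (edge x) xs ++ pairs xs

∈-pairs⁻ : ∀ {xs : List (Fin n)} {x y} → edge x y ∈ˡ pairs xs → x ∈ˡ xs
∈-pairs⁻ {xs = z ∷ xs} {x} {y} e∈ with ∈ˡ.∈-++⁻ (map (edge z) xs) e∈
... | inj₂ q = there (∈-pairs⁻ q)
... | inj₁ q with ∈ˡ.∈-map⁻ (edge z) q
...   | w , w∈ , eq with edge-injective x y z w eq
...     | inj₁ (refl , _) = here refl
...     | inj₂ (refl , _) = there w∈

pairs-unique : ∀ {xs : List (Fin n)} → Unique xs → Unique (pairs xs)
pairs-unique []              = []
pairs-unique {xs = x ∷ xs} (x∉xs ∷ unique) = Uniqueₚ.++⁺ (Uniqueₚ.map⁺ edge-injectiveʳ unique) (pairs-unique unique)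
  λ (p , q) → case (∈ˡ.∈-map⁻ (edge x) p) q
  where
  case : ∀ {e} → ∃[ y ] y ∈ˡ xs × e ≡ edge x y → ¬ e ∈ˡ pairs xs
  case (y , _ , refl) q = All.lookup x∉xs (∈-pairs⁻ q) refl

choose₂ : ℕ → ℕ
choose₂ zero    = 0
choose₂ (suc m) = m + choose₂ m

choose₂-*2 : ∀ m → 2 * choose₂ m + m ≡ m * m
choose₂-*2 zero    = refl
choose₂-*2 (suc m) = trans (e₁ m (choose₂ m)) (trans (cong (λ x → x + suc (m + m)) (choose₂-*2 m)) (e₂ m))
  where
  e₁ : ∀ m c → 2 * (m + c) + suc m ≡ 2 * c + m + suc (m + m)
  e₁ = solve-∀
  e₂ : ∀ m → m * m + suc (m + m) ≡ suc m * suc m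
  e₂ = solve-∀

length-pairs : ∀ (xs : List (Fin n)) → length (pairs xs) ≡ choose₂ (length xs)
length-pairs []       = refl
length-pairs (x ∷ xs) = trans (Listₚ.length-++ (map (edge x) xs))
  (cong₂ _+_ (Listₚ.length-map (edge x) xs) (length-pairs xs))

tuples : ∀ n → ℕ → List (List (Fin n))
tuples n zero    = [] ∷ []
tuples n (suc m) = cartesianProductWith _∷_ (allFin n) (tuples n m)

length-tuples : ∀ n m → length (tuples n m) ≡ n ^ m
length-tuples n zero    = refl
length-tuples n (suc m) = trans (length-cartesianProductWith _∷_ (allFin n) (tuples n m))
  (cong₂ _*_ (length-allFin n) (length-tuples n m))

∈-tuples : ∀ (xs : List (Fin n)) → xs ∈ˡ tuples n (length xs)
∈-tuples []       = here refl
∈-tuples (x ∷ xs) = ∈ˡ.∈-cartesianProductWith⁺ _∷_ (∈ˡ.∈-allFin x) (∈-tuples xs)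

∈-tuples⁻ : ∀ n m {xs} → xs ∈ˡ tuples n m → length xs ≡ m
∈-tuples⁻ n zero    (here refl) = refl
∈-tuples⁻ n (suc m) i with ∈ˡ.∈-cartesianProductWith⁻ _∷_ (allFin n) (tuples n m) i
... | _ , _ , _ , j , refl = cong suc (∈-tuples⁻ n m j)

module ShortOddCycles {n : ℕ} where

  -- A subset of the codes may contain diagonal pairs, hence the clause `i ≢ j`.
  Adj : Subset (n * n) → Fin n → Fin n → Set
  Adj g i j = i ≢ j × edge i j ∈ g

  adj? : ∀ g i j → Dec (Adj g i j)
  adj? g i j = ¬? (i Finₚ.≟ j) ×-dec (edge i j ∈? g)

  adj-sym : ∀ {g i j} → Adj g i j → Adj g j i
  adj-sym {g} (i≢j , e) = i≢j ∘ sym , subst (_∈ g) (edge-sym _ _) e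

  adj-⊕ : ∀ {g a i j} → Adj g i j → Adj (g ⊕ a) i j
  adj-⊕ {g} (i≢j , e) = i≢j , ⊆-⊕ g e

  adj-⊕⁻ : ∀ {g a i j} → Adj (g ⊕ a) i j → edge i j ≡ a ⊎ Adj g i j
  adj-⊕⁻ {g} (i≢j , e) with ∈-⊕⁻ g e
  ... | inj₁ eq = inj₁ eq
  ... | inj₂ e′ = inj₂ (i≢j , e′)

  Triangle : Subset (n * n) → Fin n → Fin n → Fin n → Set
  Triangle g i j k = Adj g i j × Adj g j k × Adj g k i

  -- Distinctness of the vertices two steps apart; consecutive ones differ by `Adj`, so a `Pentagon`
  -- is a genuine 5-cycle.
  Chordless : Fin n → Fin n → Fin n → Fin n → Fin n → Set
  Chordless i j k l m = i ≢ k × i ≢ l × j ≢ l × j ≢ m × k ≢ m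

  Pentagon : Subset (n * n) → Fin n → Fin n → Fin n → Fin n → Fin n → Set
  Pentagon g i j k l m = Chordless i j k l m × Adj g i j × Adj g j k × Adj g k l × Adj g l m × Adj g m i

  Good : Subset (n * n) → Set
  Good g = (∀ i j k → ¬ Triangle g i j k) × (∀ i j k l m → ¬ Pentagon g i j k l m)

  abstract
    good? : ∀ g → Dec (Good g)
    good? g = (all? λ i → all? λ j → all? λ k → ¬? (adj? g i j ×-dec adj? g j k ×-dec adj? g k i))
      ×-dec (all? λ i → all? λ j → all? λ k → all? λ l → all? λ m →
        ¬? ((¬? (i Finₚ.≟ k) ×-dec ¬? (i Finₚ.≟ l) ×-dec ¬? (j Finₚ.≟ l) ×-dec ¬? (j Finₚ.≟ m) ×-dec ¬? (k Finₚ.≟ m))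
          ×-dec adj? g i j ×-dec adj? g j k ×-dec adj? g k l ×-dec adj? g l m ×-dec adj? g m i))

  good-⊥ : Good ⊥
  good-⊥ = (λ _ _ _ ((_ , e) , _) → ∉⊥ e) , λ _ _ _ _ _ (_ , (_ , e) , _) → ∉⊥ e

  good-⊕⁻ : ∀ g a → Good (g ⊕ a) → Good g
  good-⊕⁻ g a (tri , pent) =
    (λ i j k (p , q , r) → tri i j k (adj-⊕ p , adj-⊕ q , adj-⊕ r)) ,
    λ i j k l m (c , p , q , r , s , t) →
      pent i j k l m (c , adj-⊕ p , adj-⊕ q , adj-⊕ r , adj-⊕ s , adj-⊕ t)

  link₃ : Fin n → Fin n → Fin n → List (Fin (n * n))
  link₃ i j k = edge j k ∷ edge k i ∷ []

  link₅ : Fin n → Fin n → Fin n × Fin n × Fin n → List (Fin (n * n))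
  link₅ i j (k , l , m) = edge j k ∷ edge k l ∷ edge l m ∷ edge m i ∷ []

  triples : List (Fin n × Fin n × Fin n)
  triples = cartesianProduct (allFin n) (cartesianProduct (allFin n) (allFin n))

  allLinks : Fin n × Fin n → List (List (Fin (n * n)))
  allLinks (i , j) = map (link₃ i j) (allFin n) ++ map (link₅ i j) triples

  open DecUnique (Finₚ._≟_ {n * n}) using (unique?)

  -- Degenerate choices of the inner vertices can repeat an edge; they are filtered out because
  -- `tot-containing` gains a factor `M` only for each distinct edge.
  links : Fin (n * n) → List (List (Fin (n * n)))
  links a = filter unique? (allLinks (ends a))

  links-unique : ∀ a A → A ∈ˡ links a → Unique A
  links-unique a A i = proj₂ (∈ˡ.∈-filter⁻ unique? {xs = allLinks (ends a)} i)

  allLinks-short : ∀ ij A → A ∈ˡ allLinks ij → length A ≤ 4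
  allLinks-short (i , j) A p with ∈ˡ.∈-++⁻ (map (link₃ i j) (allFin n)) p
  allLinks-short (i , j) A p | inj₁ q with ∈ˡ.∈-map⁻ (link₃ i j) q
  ... | _ , _ , refl = s≤s (s≤s z≤n)
  allLinks-short (i , j) A p | inj₂ q with ∈ˡ.∈-map⁻ (link₅ i j) q
  ... | _ , _ , refl = ≤-refl

  links-short : ∀ a A → A ∈ˡ links a → length A ≤ 4
  links-short a A p = allLinks-short (ends a) A (proj₁ (∈ˡ.∈-filter⁻ unique? {xs = allLinks (ends a)} p))

  -- There are at most `n` links of two edges, counted `M ^ 2` each, and at most n³ of four edges,
  -- counted 1 each.
  links-weight : ∀ M → 2 * (n * M ^ 2 + n * n * n) ≤ M ^ 4 →
    ∀ a → 2 * ∑[ A ∈ links a ] (M ^ (4 ∸ length A)) ≤ M ^ 4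
  links-weight M few a = ≤-trans (*-monoʳ-≤ 2 bound) few
    where
    open ≤-Reasoning
    f : List (Fin (n * n)) → ℕ
    f A = M ^ (4 ∸ length A)
    u = proj₁ (ends a)
    v = proj₂ (ends a)
    length-triples : length triples ≡ n * n * n
    length-triples = trans (length-cartesianProductWith _,_ (allFin n) (cartesianProduct (allFin n) (allFin n)))
      (trans (cong₂ _*_ (length-allFin n) (trans (length-cartesianProductWith _,_ (allFin n) (allFin n))
        (cong₂ _*_ (length-allFin n) (length-allFin n)))) (sym (*-assoc n n n)))
    bound : ∑ (links a) f ≤ n * M ^ 2 + n * n * n
    bound = begin
      ∑ (links a) f
        ≡⟨ ∑-filter unique? f (allLinks (ends a)) ⟩
      ∑[ A ∈ allLinks (ends a) ] (⟦ unique? A ⟧ * f A)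
        ≤⟨ ∑-mono (allLinks (ends a)) (λ A _ → ⟦⟧*-≤ (unique? A) λ _ → ≤-refl) ⟩
      ∑ (allLinks (ends a)) f
        ≡⟨ ∑-++ (map (link₃ u v) (allFin n)) (map (link₅ u v) triples) f ⟩
      ∑ (map (link₃ u v) (allFin n)) f + ∑ (map (link₅ u v) triples) f
        ≡⟨ cong₂ _+_
             (trans (∑-map (link₃ u v) (allFin n) f) (trans (∑-const (allFin n) (M ^ 2)) (cong (_* M ^ 2) (length-allFin n))))
             (trans (∑-map (link₅ u v) triples f) (trans (∑-const triples 1) (trans (*-identityʳ _) length-triples))) ⟩
      n * M ^ 2 + n * n * n ∎

  module _ (g : Subset (n * n)) (a : Fin (n * n)) (good : Good g)
           (unlinked : ∀ A → A ∈ˡ links a → ¬ All (_∈ g) A) where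

    old : ∀ {i j k l : Fin n} → edge i j ≡ a → edge k l ≢ edge i j → Adj (g ⊕ a) k l → edge k l ∈ g
    old eq ≢ij e with adj-⊕⁻ e
    ... | inj₁ eq′     = ⊥-elim (≢ij (trans eq′ (sym eq)))
    ... | inj₂ (_ , e′) = e′

    triangle-through : ∀ {i j k} → ends a ≡ (i , j) → edge i j ≡ a → ¬ Triangle (g ⊕ a) i j k
    triangle-through {i} {j} {k} ends≡ eq ((i≢j , _) , jk@(j≢k , _) , ki@(k≢i , _)) =
      unlinked (link₃ i j k) (∈ˡ.∈-filter⁺ unique? listed (((edge-≢ˡ j≢k (i≢j ∘ sym)) ∷ []) ∷ [] ∷ []))
        (old eq (edge-≢ʳ k≢i (j≢k ∘ sym)) jk ∷ old eq (edge-≢ˡ k≢i (j≢k ∘ sym)) ki ∷ [])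
      where
      listed : link₃ i j k ∈ˡ allLinks (ends a)
      listed rewrite ends≡ = ∈ˡ.∈-++⁺ˡ (∈ˡ.∈-map⁺ (link₃ i j) (∈ˡ.∈-allFin k))

    triangle-at : ∀ {i j k} → edge i j ≡ a → ¬ Triangle (g ⊕ a) i j k
    triangle-at {i} {j} {k} refl t@(ij , jk , ki) with ends-edge i j
    ... | inj₁ e = triangle-through e refl t
    -- The links of `a` run between its ends in the fixed order of `ends a`; an edge met in the
    -- other direction calls for the mirror image of the cycle.
    ... | inj₂ e = triangle-through e (edge-sym j i) (adj-sym ij , adj-sym ki , adj-sym jk)

    no-triangle : ∀ i j k → ¬ Triangle (g ⊕ a) i j k
    no-triangle i j k t@(ij , jk , ki) with adj-⊕⁻ ij | adj-⊕⁻ jk | adj-⊕⁻ ki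
    ... | inj₁ e | _      | _      = triangle-at e t
    ... | inj₂ _ | inj₁ e | _      = triangle-at e (jk , ki , ij)
    ... | inj₂ _ | inj₂ _ | inj₁ e = triangle-at e (ki , ij , jk)
    ... | inj₂ p | inj₂ q | inj₂ r = proj₁ good i j k (p , q , r)

    pentagon-through : ∀ {i j k l m} → ends a ≡ (i , j) → edge i j ≡ a → ¬ Pentagon (g ⊕ a) i j k l m
    pentagon-through {i} {j} {k} {l} {m} ends≡ eq
      ((i≢k , i≢l , j≢l , j≢m , k≢m) , (i≢j , _) , jk@(j≢k , _) , kl@(k≢l , _) , lm@(l≢m , _) , mi@(m≢i , _)) =
      unlinked (link₅ i j (k , l , m)) (∈ˡ.∈-filter⁺ unique? listed
          ((edge-≢ˡ j≢k j≢l ∷ edge-≢ˡ j≢l j≢m ∷ edge-≢ˡ j≢m (i≢j ∘ sym) ∷ []) ∷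
           (edge-≢ˡ k≢l k≢m ∷ edge-≢ˡ k≢m (i≢k ∘ sym) ∷ []) ∷
           (edge-≢ˡ l≢m (i≢l ∘ sym) ∷ []) ∷ [] ∷ []))
        (old eq (edge-≢ʳ (i≢k ∘ sym) (j≢k ∘ sym)) jk ∷
         old eq (edge-≢ˡ (i≢k ∘ sym) (j≢k ∘ sym)) kl ∷
         old eq (edge-≢ˡ (i≢l ∘ sym) (j≢l ∘ sym)) lm ∷
         old eq (edge-≢ˡ m≢i (j≢m ∘ sym)) mi ∷ [])
      where
      listed : link₅ i j (k , l , m) ∈ˡ allLinks (ends a)
      listed rewrite ends≡ = ∈ˡ.∈-++⁺ʳ (map (link₃ i j) (allFin n)) (∈ˡ.∈-map⁺ (link₅ i j)
        (∈ˡ.∈-cartesianProduct⁺ (∈ˡ.∈-allFin k) (∈ˡ.∈-cartesianProduct⁺ (∈ˡ.∈-allFin l) (∈ˡ.∈-allFin m))))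

    pentagon-at : ∀ {i j k l m} → edge i j ≡ a → ¬ Pentagon (g ⊕ a) i j k l m
    pentagon-at {i} {j} refl p@((i≢k , i≢l , j≢l , j≢m , k≢m) , ij , jk , kl , lm , mi) with ends-edge i j
    ... | inj₁ e = pentagon-through e refl p
    ... | inj₂ e = pentagon-through e (edge-sym j i)
      ((j≢m , j≢l , i≢l , i≢k , k≢m ∘ sym) , adj-sym ij , adj-sym mi , adj-sym lm , adj-sym kl , adj-sym jk)

    -- The added edge may be any of the five; rotation brings it to the front, where `pentagon-at`
    -- applies.
    rotate : ∀ {h i j k l m} → Pentagon h i j k l m → Pentagon h j k l m i
    rotate ((i≢k , i≢l , j≢l , j≢m , k≢m) , ij , jk , kl , lm , mi) =
      (j≢l , j≢m , k≢m , i≢k ∘ sym , i≢l ∘ sym) , jk , kl , lm , mi , ij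

    no-pentagon : ∀ i j k l m → ¬ Pentagon (g ⊕ a) i j k l m
    no-pentagon i j k l m p@(c , ij , jk , kl , lm , mi)
      with adj-⊕⁻ ij | adj-⊕⁻ jk | adj-⊕⁻ kl | adj-⊕⁻ lm | adj-⊕⁻ mi
    ... | inj₁ e | _      | _      | _      | _      = pentagon-at e p
    ... | inj₂ _ | inj₁ e | _      | _      | _      = pentagon-at e (rotate p)
    ... | inj₂ _ | inj₂ _ | inj₁ e | _      | _      = pentagon-at e (rotate (rotate p))
    ... | inj₂ _ | inj₂ _ | inj₂ _ | inj₁ e | _      = pentagon-at e (rotate (rotate (rotate p)))
    ... | inj₂ _ | inj₂ _ | inj₂ _ | inj₂ _ | inj₁ e = pentagon-at e (rotate (rotate (rotate (rotate p))))
    ... | inj₂ q | inj₂ r | inj₂ s | inj₂ t | inj₂ u = proj₂ good i j k l m (c , q , r , s , t , u)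

    good-⊕ : Good (g ⊕ a)
    good-⊕ = no-triangle , no-pentagon

  toGraph : ∀ g → Good g → Graph n
  toGraph g (no-tri , no-pent) = record
    { E = Adj g ; E? = adj? g ; E-sym = adj-sym
    ; no-3-walk = λ p q r → no-tri _ _ _ (p , q , r)
    -- If two vertices two steps apart on the walk coincide, the other three edges form a closed
    -- walk of length 3; otherwise the walk is a pentagon.
    ; no-5-walk = λ p q r s t → no-pent _ _ _ _ _
        ( ( (λ { refl → no-tri _ _ _ (r , s , t) })
          , (λ { refl → no-tri _ _ _ (p , q , r) })
          , (λ { refl → no-tri _ _ _ (p , s , t) })
          , (λ { refl → no-tri _ _ _ (q , r , s) })
          , (λ { refl → no-tri _ _ _ (p , q , t) }) )
        , p , q , r , s , t ) }

  open DecUnique (Finₚ._≟_ {n}) using () renaming (unique? to uniqueTuple?)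

  cliques : ℕ → List (List (Fin (n * n)))
  cliques m = map pairs (filter uniqueTuple? (tuples n m))

  cliques-count : ∀ m → length (cliques m) ≤ n ^ m
  cliques-count m = ≤-trans (≤-reflexive (Listₚ.length-map pairs (filter uniqueTuple? (tuples n m))))
    (≤-trans (Listₚ.length-filter uniqueTuple? (tuples n m)) (≤-reflexive (length-tuples n m)))

  ∈-cliques⁺ : ∀ {m} {xs : List (Fin n)} → Unique xs → length xs ≡ m → pairs xs ∈ˡ cliques m
  ∈-cliques⁺ unique refl = ∈ˡ.∈-map⁺ pairs (∈ˡ.∈-filter⁺ uniqueTuple? (∈-tuples _) unique)

  ∈-cliques⁻ : ∀ m T → T ∈ˡ cliques m → Unique T × length T ≡ choose₂ m
  ∈-cliques⁻ m T i with ∈ˡ.∈-map⁻ pairs i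
  ... | xs , j , refl with ∈ˡ.∈-filter⁻ uniqueTuple? {xs = tuples n m} j
  ...   | k , unique = pairs-unique unique , trans (length-pairs xs) (cong choose₂ (∈-tuples⁻ n m k))

  pairs-missed : ∀ {g W xs} → (∀ i j → i ∈ W → j ∈ W → ¬ Adj g i j) → Unique xs → All (_∈ W) xs →
    All (_∉ g) (pairs xs)
  pairs-missed ind []              []         = []
  pairs-missed ind (x∉xs ∷ unique) (x∈ ∷ xs∈) = Allₚ.++⁺
    (Allₚ.map⁺ (All.zipWith (λ (x≢y , y∈) e → ind _ _ x∈ y∈ (x≢y , e)) (x∉xs , xs∈)))
    (pairs-missed ind unique xs∈)

  -- A larger independent set would contain `m` distinct vertices all of whose pairs are absent from
  -- `g`.
  toGraph-α≤ : ∀ m g (good : Good g) → (∀ T → T ∈ˡ cliques m → ¬ All (_∉ g) T) →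
    Graph.α≤_ (toGraph g good) m
  toGraph-α≤ m g good hit W ind with ∣ W ∣ ≤? m
  ... | yes small = small
  ... | no large  = ⊥-elim (hit (pairs (take m ws)) (∈-cliques⁺ unique len)
      (pairs-missed ind unique (Allₚ.take⁺ m (Allₚ.all-filter (_∈? W) (allFin n)))))
    where
    ws = filter (_∈? W) (allFin n)
    unique : Unique (take m ws)
    unique = Uniqueₚ.take⁺ m (Uniqueₚ.filter⁺ (_∈? W) (Uniqueₚ.allFin⁺ n))
    len : length (take m ws) ≡ m
    len = trans (Listₚ.length-take m ws) (m≤n⇒m⊓n≡m (≤-trans (<⇒≤ (≰⇒> large))
      (≤-reflexive (trans ∣ W ∣≡∑ (sym (length-filter-∑ (_∈? W) (allFin n)))))))

  random-graph : ∀ M m {{_ : NonZero M}} → 2 * (n * M ^ 2 + n * n * n) ≤ M ^ 4 →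
    n ^ m * (2 * M) ^ choose₂ m < suc (2 * M) ^ choose₂ m →
    Σ (Graph n) λ G → Graph.α≤_ G m
  random-graph M m few count =
    let g , good , hit = RandomGood.transversal M Good good? good-⊥ good-⊕⁻
          links links-unique links-short (links-weight M few)
          (λ g a good _ unlinked → good-⊕ g a good unlinked)
          (choose₂ m) (cliques m) (∈-cliques⁻ m)
          (≤-<-trans (*-monoˡ-≤ ((2 * M) ^ choose₂ m) (cliques-count m)) count)
    in toGraph g good , toGraph-α≤ m g good hit

-- Colourings and graphs

allColor? : {P : Color → Set} → (∀ x → Dec (P x)) → Dec (∀ x → P x)
allColor? P? = map′ (λ { (r , b , y) red → r ; (r , b , y) blue → b ; (r , b , y) yellow → y })
  (λ f → f red , f blue , f yellow) (P? red ×-dec P? blue ×-dec P? yellow)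

-- Membership in `ℋ` without permutations: two reds and a third colour other than yellow, or two
-- yellows and a red. The three variants of each say which vertex the two like edges share.
Bad : Color → Color → Color → Set
Bad x y z = (x ≡ red × y ≡ red × z ≢ yellow) ⊎ (z ≡ red × x ≡ red × y ≢ yellow) ⊎ (y ≡ red × z ≡ red × x ≢ yellow)
          ⊎ (x ≡ yellow × y ≡ yellow × z ≡ red) ⊎ (z ≡ yellow × x ≡ yellow × y ≡ red) ⊎ (y ≡ yellow × z ≡ yellow × x ≡ red)

-- Decided by inspection of all 27 colour triples.
instance⇒bad : ∀ x y z → (x ∷ y ∷ z ∷ []) isInstanceOf ℋ → Bad x y z
instance⇒bad = from-yes (allColor? λ x → allColor? λ y → allColor? λ z →
  isInstanceOf? (x ∷ y ∷ z ∷ []) ℋ →-dec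
  ((x ≟ᶜ red ×-dec y ≟ᶜ red ×-dec ¬? (z ≟ᶜ yellow)) ⊎-dec
   (z ≟ᶜ red ×-dec x ≟ᶜ red ×-dec ¬? (y ≟ᶜ yellow)) ⊎-dec
   (y ≟ᶜ red ×-dec z ≟ᶜ red ×-dec ¬? (x ≟ᶜ yellow)) ⊎-dec
   (x ≟ᶜ yellow ×-dec y ≟ᶜ yellow ×-dec z ≟ᶜ red) ⊎-dec
   (z ≟ᶜ yellow ×-dec x ≟ᶜ yellow ×-dec y ≟ᶜ red) ⊎-dec
   (y ≟ᶜ yellow ×-dec z ≟ᶜ yellow ×-dec x ≟ᶜ red)))

missing-color : ∀ x y → ∃[ z ] z ≢ x × z ≢ y
missing-color = from-yes (allColor? λ x → allColor? λ y → searchColor λ z → ¬? (z ≟ᶜ x) ×-dec ¬? (z ≟ᶜ y))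

module RedGraph (c : Coloring n) (avoids : Avoids c ℋ) where

  red-red : ∀ {i j k} → i ≢ j → j ≢ k → i ≢ k → color c i j ≡ red → color c j k ≡ red → color c i k ≡ yellow
  red-red {i} {j} {k} i≢j j≢k i≢k ij jk with avoids i j k i≢j j≢k i≢k
  ... | av rewrite ij | jk with color c i k
  ...   | red    = ⊥-elim (av (here ↭-refl))
  ...   | blue   = ⊥-elim (av (there (here ↭-refl)))
  ...   | yellow = refl

  yellow-yellow : ∀ {i j k} → i ≢ j → j ≢ k → i ≢ k → color c i j ≡ yellow → color c j k ≡ yellow →
    color c i k ≢ red
  yellow-yellow {i} {j} {k} i≢j j≢k i≢k ij jk ik with avoids i j k i≢j j≢k i≢k
  ... | av rewrite ij | jk | ik = av (there (there (here ↭-refl)))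

  Red : Fin n → Fin n → Set
  Red i j = i ≢ j × color c i j ≡ red

  no-triangle : ∀ {i j k} → Red i j → Red j k → ¬ Red k i
  no-triangle {i} {j} {k} (i≢j , ij) (j≢k , jk) (k≢i , ki)
    with trans (sym (red-red i≢j j≢k (k≢i ∘ sym) ij jk)) (trans (color-sym c i k) ki)
  ... | ()

  -- Red edges at `j` and at `l` make `ik` and `km` yellow, and two yellow edges at `k` exclude red
  -- on `im`. If `i` = `k` or `k` = `m`, the walk collapses to a red triangle.
  no-pentagon : ∀ {i j k l m} → Red i j → Red j k → Red k l → Red l m → ¬ Red m i
  no-pentagon {i} {j} {k} {l} {m} r₁@(i≢j , ij) r₂@(j≢k , jk) r₃@(k≢l , kl) r₄@(l≢m , lm) r₅@(m≢i , mi) =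
    yellow-yellow i≢k k≢m (m≢i ∘ sym) (red-red i≢j j≢k i≢k ij jk) (red-red k≢l l≢m k≢m kl lm)
      (trans (color-sym c i m) mi)
    where
    i≢k : i ≢ k
    i≢k refl = no-triangle r₃ r₄ r₅
    k≢m : k ≢ m
    k≢m refl = no-triangle r₁ r₂ r₅

  graph : Graph n
  graph = record
    { E = Red
    ; E? = λ i j → ¬? (i Finₚ.≟ j) ×-dec (color c i j ≟ᶜ red)
    ; E-sym = λ (i≢j , r) → i≢j ∘ sym , trans (color-sym c _ _) r
    ; no-3-walk = no-triangle
    ; no-5-walk = no-pentagon }

  -- A set without red edges is coloured blue and yellow only.
  graph-α≤ : ∀ {h} → IsH₂Coloring c h → Graph.α≤_ graph h
  graph-α≤ (_ , max) W ind = max ∣ W ∣ (W , refl , blue , yellow , λ i j i∈ j∈ i≢j →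
    not-red (λ r → ind i j i∈ j∈ (i≢j , r)))
    where
    not-red : ∀ {x} → x ≢ red → x ≡ blue ⊎ x ≡ yellow
    not-red {red}    x≢ = ⊥-elim (x≢ refl)
    not-red {blue}   x≢ = inj₁ refl
    not-red {yellow} x≢ = inj₂ refl

-- Given the red graph, ℋ-freeness forces yellow on the pairs with a common red neighbour.
module Coloured (G : Graph n) where
  open Graph G
  open Spheres G

  paint : Bool → Bool → Color
  paint true  _     = red
  paint false true  = yellow
  paint false false = blue

  toColoring : Coloring n
  toColoring = coloring
    (λ i j → paint (does (E? i j)) (does (sphere₂? i j)))
    (λ i j → cong₂ paint
      (does-⇔ (mk⇔ E-sym E-sym) (E? i j) (E? j i))
      (does-⇔ (mk⇔ back back) (sphere₂? i j) (sphere₂? j i)))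
    where
    back : ∀ {i j} → ∃[ a ] E i a × E a j → ∃[ a ] E j a × E a i
    back (a , p , q) = a , E-sym q , E-sym p

  private
    col = color toColoring

  red⇒E : ∀ {i j} → col i j ≡ red → E i j
  red⇒E {i} {j} eq with E? i j | sphere₂? i j
  ... | yes e | _     = e
  red⇒E () | no _ | yes _
  red⇒E () | no _ | no _

  E⇒red : ∀ {i j} → E i j → col i j ≡ red
  E⇒red {i} {j} e with E? i j
  ... | yes _ = refl
  ... | no ¬e = ⊥-elim (¬e e)

  yellow⇒path : ∀ {i j} → col i j ≡ yellow → ∃[ a ] E i a × E a j
  yellow⇒path {i} {j} eq with E? i j | sphere₂? i j
  yellow⇒path () | yes _ | _
  ... | no _ | yes p = p
  yellow⇒path () | no _ | no _

  -- A pair with a common neighbour is not an edge, for lack of triangles; so the priority of red in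
  -- `paint` never hides a path of length two.
  path⇒yellow : ∀ {i a j} → E i a → E a j → col i j ≡ yellow
  path⇒yellow {i} {a} {j} p q with E? i j | sphere₂? i j
  ... | yes e | _      = ⊥-elim (no-3-walk p q (E-sym e))
  ... | no _  | yes _  = refl
  ... | no _  | no none = ⊥-elim (none (a , p , q))

  -- Two red edges at a vertex form a path, which makes the third edge yellow. Two yellow edges
  -- stand for paths of length two, and a red third edge would close them to a walk of length 5.
  avoids : Avoids toColoring ℋ
  avoids i j k _ _ _ inst = refute (instance⇒bad (col i j) (col j k) (col i k) inst)
    where
    flip : ∀ {i j x} → col i j ≡ x → col j i ≡ x
    flip {i} {j} = trans (color-sym toColoring j i)
    pentagon : ∀ {x y z} → col x y ≡ yellow → col y z ≡ yellow → col x z ≢ red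
    pentagon xy yz xz = let _ , p , q = yellow⇒path xy ; _ , r , s = yellow⇒path yz in
      no-5-walk p q r s (E-sym (red⇒E xz))
    refute : ¬ Bad (col i j) (col j k) (col i k)
    refute (inj₁ (ij , jk , ik))                             = ik (path⇒yellow (red⇒E ij) (red⇒E jk))
    refute (inj₂ (inj₁ (ik , ij , jk)))                      = jk (path⇒yellow (red⇒E (flip ij)) (red⇒E ik))
    refute (inj₂ (inj₂ (inj₁ (jk , ik , ij))))               = ij (path⇒yellow (red⇒E ik) (red⇒E (flip jk)))
    refute (inj₂ (inj₂ (inj₂ (inj₁ (ij , jk , ik)))))        = pentagon ij jk ik
    refute (inj₂ (inj₂ (inj₂ (inj₂ (inj₁ (ik , ij , jk)))))) = pentagon (flip ij) ik jk
    refute (inj₂ (inj₂ (inj₂ (inj₂ (inj₂ (jk , ik , ij)))))) = pentagon ik (flip jk) ij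

  module _ {m : ℕ} (α : α≤ m) (S : Subset n) where

    Omits : Color → Set
    Omits z = ∀ {i j} → i ∈ S → j ∈ S → i ≢ j → col i j ≢ z

    E⇒≢ : ∀ {i j} → E i j → i ≢ j
    E⇒≢ e refl = irrefl e

    -- Red is a matching on S; split S into upper ends of red edges and the rest.
    no-yellow : Omits yellow → ∣ S ∣ ≤ m + (m + m)
    -- `lower` enters twice only to bring 2m into the common shape of a bound by 3m.
    no-yellow omit = ≤-trans (∣∣-cover S upper lower lower cover)
      (+-mono-≤ (α upper upper-indep) (+-mono-≤ (α lower lower-indep) (α lower lower-indep)))
      where
      above? : ∀ i → Dec (∃[ j ] j ∈ S × j Fin.< i × E i j)
      above? i = any? λ j → (j ∈? S) ×-dec (j Finₚ.<? i) ×-dec E? i j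
      upper? = λ i → (i ∈? S) ×-dec above? i
      lower? = λ i → (i ∈? S) ×-dec ¬? (above? i)
      upper = subset upper?
      lower = subset lower?
      -- The far ends of two red edges at `i` would form a yellow pair inside `S`.
      matching : ∀ {i j k} → j ∈ S → k ∈ S → E i j → E i k → j ≡ k
      matching {i} {j} {k} j∈ k∈ p q with j Finₚ.≟ k
      ... | yes eq = eq
      ... | no j≢k = ⊥-elim (omit j∈ k∈ j≢k (path⇒yellow (E-sym p) q))
      -- The only red neighbour of `i` in `S` lies below `i`, so it cannot be the larger `j`.
      no-chain : ∀ {i j} → i ∈ upper → j ∈ upper → i Fin.< j → ¬ E j i
      no-chain i∈ j∈ i<j e =
        let i∈S , k , k∈S , k<i , e′ = ∈-subset⁻ upper? i∈
            j∈S , _ = ∈-subset⁻ upper? j∈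
        in Finₚ.<-irrefl (matching k∈S j∈S e′ (E-sym e)) (Finₚ.<-trans k<i i<j)
      upper-indep : Independent upper
      upper-indep i j i∈ j∈ e with Finₚ.<-cmp i j
      ... | tri< i<j _ _  = no-chain i∈ j∈ i<j (E-sym e)
      ... | tri≈ _ i≡j _  = E⇒≢ e i≡j
      ... | tri> _ _ j<i  = no-chain j∈ i∈ j<i e
      not-above : ∀ {i j} → i ∈ lower → j ∈ lower → i Fin.< j → ¬ E j i
      not-above i∈ j∈ i<j e = proj₂ (∈-subset⁻ lower? j∈) (_ , proj₁ (∈-subset⁻ lower? i∈) , i<j , e)
      lower-indep : Independent lower
      lower-indep i j i∈ j∈ e with Finₚ.<-cmp i j
      ... | tri< i<j _ _  = not-above i∈ j∈ i<j (E-sym e)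
      ... | tri≈ _ i≡j _  = E⇒≢ e i≡j
      ... | tri> _ _ j<i  = not-above j∈ i∈ j<i e
      cover : ∀ i → i ∈ S → i ∈ upper ⊎ i ∈ lower ⊎ i ∈ lower
      cover i i∈ with above? i
      ... | yes p = inj₁ (∈-subset⁺ upper? (i∈ , p))
      ... | no ¬p = inj₂ (inj₁ (∈-subset⁺ lower? (i∈ , ¬p)))

    -- Seen from any `v` in `S`, every other vertex of `S` is joined to `v` by red or yellow, hence
    -- is a neighbour of `v` or lies in `sphere₂ v`.
    no-blue : Omits blue → ∣ S ∣ ≤ m + (m + m)
    no-blue omit with any? (_∈? S)
    ... | no empty = ≤-trans (α S λ i j i∈ → ⊥-elim (empty (i , i∈))) (m≤m+n _ _)
    ... | yes (v , v∈) = ≤-trans (∣∣-cover S ⁅ v ⁆ (nbrs v ⊤) (sphere₂ v) cover)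
      (+-mono-≤ (α ⁅ v ⁆ single) (+-mono-≤ (α (nbrs v ⊤) (nbrs-independent v ⊤))
                                           (α (sphere₂ v) (sphere₂-independent v))))
      where
      single : Independent ⁅ v ⁆
      single i j i∈ j∈ e = E⇒≢ e (trans (x∈⁅y⁆⇒x≡y v i∈) (sym (x∈⁅y⁆⇒x≡y v j∈)))
      cover : ∀ i → i ∈ S → i ∈ ⁅ v ⁆ ⊎ i ∈ nbrs v ⊤ ⊎ i ∈ sphere₂ v
      cover i i∈ with v Finₚ.≟ i
      ... | yes refl = inj₁ (x∈⁅x⁆ v)
      ... | no v≢i with col v i in eq
      ...   | red    = inj₂ (inj₁ (∈-subset⁺ (λ u → E? v u ×-dec (u ∈? ⊤)) (red⇒E eq , ∈⊤)))
      ...   | blue   = ⊥-elim (omit v∈ i∈ v≢i eq)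
      ...   | yellow = inj₂ (inj₂ (∈-subset⁺ (sphere₂? v) (yellow⇒path eq)))

    two-colored≤ : UsesAtMostTwoColors toColoring S → ∣ S ∣ ≤ m + (m + m)
    two-colored≤ (x , y , two) with missing-color x y
    ... | z , z≢x , z≢y = bound z λ i∈ j∈ i≢j eq → omits i∈ j∈ i≢j eq (two _ _ i∈ j∈ i≢j)
      where
      omits : ∀ {i j} → i ∈ S → j ∈ S → i ≢ j → col i j ≡ z → ¬ (col i j ≡ x ⊎ col i j ≡ y)
      omits _ _ _ eq (inj₁ p) = z≢x (trans (sym eq) p)
      omits _ _ _ eq (inj₂ p) = z≢y (trans (sym eq) p)
      bound : ∀ z → Omits z → ∣ S ∣ ≤ m + (m + m)
      bound red    omit = ≤-trans (α S λ i j i∈ j∈ e → omit i∈ j∈ (E⇒≢ e) (E⇒red e)) (m≤m+n _ _)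
      bound yellow omit = no-yellow omit
      bound blue   omit = no-blue omit

h₂≤ : (G : Graph n) → ∀ {m} → Graph.α≤_ G m → h₂ n ℋ (allBlue n) ≤ m + (m + m)
h₂≤ {n} G {m} α with h₂Coloring-exists (Coloured.toColoring G)
... | k , max@((S , refl , two) , _) = ≤-trans
  (proj₂ (h₂-spec n ℋ (allBlue n)) k ((Coloured.toColoring G , Coloured.avoids G) , max))
  (Coloured.two-colored≤ G α S two)

-- From independence numbers to the asymptotic bounds

bracket : (f : ℕ → ℕ) (N k : ℕ) → f 0 ≤ N → N < f k → ∃[ l ] f l ≤ N × N < f (suc l)
bracket f N zero    lo hi = ⊥-elim (<⇒≱ hi lo)
bracket f N (suc k) lo hi with f k ≤? N
... | yes p = k , p , hi
... | no ¬p = bracket f N k lo (≰⇒> ¬p)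

^-distribʳ-* : ∀ o m n → (m * n) ^ o ≡ m ^ o * n ^ o
^-distribʳ-* zero    m n = refl
^-distribʳ-* (suc o) m n = trans (cong (m * n *_) (^-distribʳ-* o m n)) (shuffle m n (m ^ o) (n ^ o))
  where
  shuffle : ∀ a b c d → a * b * (c * d) ≡ a * c * (b * d)
  shuffle = solve-∀

2^-cancel-≤ : ∀ {a b} → 2 ^ a ≤ 2 ^ b → a ≤ b
2^-cancel-≤ {a} {b} le with a ≤? b
... | yes p = p
... | no ¬p = ⊥-elim (<⇒≱ (^-monoʳ-< 2 (s≤s (s≤s z≤n)) (≰⇒> ¬p)) le)

-- Used with a = 32 from `α-bound`, b = 25 from `log-bound` and c = 10, where 32·25 = 800 ≤ 10³.
Ω-arithmetic : ∀ a b c {n p q L h} → a * b ≤ c * c * c → n * n * L ≤ a * (h * h * h) → p ≤ b * L * q →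
  1 ^ 3 * (n ^ 2 * p ^ 1) ≤ (c * h) ^ 3 * q ^ 1
Ω-arithmetic a b c {n} {p} {q} {L} {h} ab≤c³ n²L≤ p≤ = begin
  1 ^ 3 * (n ^ 2 * p ^ 1)      ≡⟨ e₁ n p ⟩
  n * n * p                    ≤⟨ *-monoʳ-≤ (n * n) p≤ ⟩
  n * n * (b * L * q)          ≡⟨ e₂ n L q b ⟩
  n * n * L * (b * q)          ≤⟨ *-monoˡ-≤ (b * q) n²L≤ ⟩
  a * (h * h * h) * (b * q)    ≡⟨ e₃ a b (h * h * h) q ⟩
  a * b * (h * h * h * q)      ≤⟨ *-monoˡ-≤ (h * h * h * q) ab≤c³ ⟩
  c * c * c * (h * h * h * q)  ≡⟨ e₄ c h q ⟩
  (c * h) ^ 3 * q ^ 1          ∎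
  where
  open ≤-Reasoning
  e₁ : ∀ n p → 1 * ((n * (n * 1)) * (p * 1)) ≡ n * n * p
  e₁ = solve-∀
  e₂ : ∀ n L q b → n * n * (b * L * q) ≡ n * n * L * (b * q)
  e₂ = solve-∀
  e₃ : ∀ a b x q → a * x * (b * q) ≡ a * b * (x * q)
  e₃ = solve-∀
  e₄ : ∀ c h q → c * c * c * (h * h * h * q) ≡ ((c * h) * ((c * h) * ((c * h) * 1))) * (q * 1)
  e₄ = solve-∀

-- The value L = l + 1 found by bracketing is at least (log n)/25, because 9(l + 2) + 7 ≤ 25(l + 1),
-- with equality at l = 0.
log-bound : ∀ {n p q l} → 2 ^ p ≤ n ^ q → n < 2 ^ (9 * suc (suc l) + 7) → p ≤ 25 * suc l * q
log-bound {n} {p} {q} {l} 2^p≤n^q n< = 2^-cancel-≤ (begin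
  2 ^ p                  ≤⟨ 2^p≤n^q ⟩
  n ^ q                  ≤⟨ ^-monoˡ-≤ q (<⇒≤ n<) ⟩
  (2 ^ e) ^ q            ≡⟨ ^-*-assoc 2 e q ⟩
  2 ^ (e * q)            ≤⟨ ^-monoʳ-≤ 2 (*-monoˡ-≤ q (≤-trans (m≤m+n e (16 * l)) (≤-reflexive (exponent l)))) ⟩
  2 ^ (25 * suc l * q)   ∎)
  where
  open ≤-Reasoning
  e = 9 * suc (suc l) + 7
  exponent : ∀ l → 9 * suc (suc l) + 7 + 16 * l ≡ 25 * suc l
  exponent = solve-∀

lower-bound : (λ n → h₂ n ℋ (allBlue n)) isΩ ([n^ 2 ·log^ 1 ]^1/ 3)
-- 2^16 is 2^(9L + 7) at L = 1, so from there on bracketing yields a positive `L`.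
lower-bound = 1 , 10 , 2 ^ 16 , s≤s z≤n , s≤s z≤n , bound
  where
  bound : ∀ n → n ≥ 2 ^ 16 → 1 / 10 · [n^ 2 ·log^ 1 ]^1/ 3 at n ≤ h₂ n ℋ (allBlue n)
  bound n n≥ p q _ 2^p≤n^q with h₂ n ℋ (allBlue n) | h₂-spec n ℋ (allBlue n)
  ... | h | ((c , av) , isH₂) , _ with bracket (λ l → 2 ^ (9 * l + 7)) n n
        (≤-trans (m≤m+n 128 65408) n≥)
        (<-≤-trans (m<2^m n) (^-monoʳ-≤ 2 (m≤n⇒m≤n+o 7 (m≤n*m n 9))))
  ...   | zero  , _  , n<    = ⊥-elim (<⇒≱ n< n≥)
  ...   | suc l , n≥2^ , n<2^ = Ω-arithmetic 32 25 10 {n} {p} {q} {suc l} {h} (m≤m+n 800 200)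
    (α-bound (RedGraph.graph c av) {h} {suc l} (RedGraph.graph-α≤ c av isH₂) (s≤s z≤n) n≥2^)
    (log-bound {n} {p} {q} {l} 2^p≤n^q n<2^)

-- Bernoulli, with the division by x cleared.
bernoulli : ∀ x k → x ^ k * (x + k) ≤ x * suc x ^ k
bernoulli x zero    = ≤-reflexive (e x)
  where
  e : ∀ x → 1 * (x + 0) ≡ x * 1
  e = solve-∀
bernoulli x (suc k) = begin
  x * x ^ k * (x + suc k)                ≤⟨ m≤m+n _ (x ^ k * k) ⟩
  x * x ^ k * (x + suc k) + x ^ k * k    ≡⟨ e₁ x k (x ^ k) ⟩
  suc x * (x ^ k * (x + k))              ≤⟨ *-monoʳ-≤ (suc x) (bernoulli x k) ⟩
  suc x * (x * suc x ^ k)                ≡⟨ e₂ x (suc x ^ k) ⟩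
  x * (suc x * suc x ^ k)                ∎
  where
  open ≤-Reasoning
  e₁ : ∀ x k y → x * y * (x + suc k) + y * k ≡ suc x * (y * (x + k))
  e₁ = solve-∀
  e₂ : ∀ x y → suc x * (x * y) ≡ x * (suc x * y)
  e₂ = solve-∀

-- Bernoulli at exponent `x`: (1 + 1/x)^x ≥ 2.
2x^x≤ : ∀ x .{{_ : NonZero x}} → 2 * x ^ x ≤ suc x ^ x
2x^x≤ x = *-cancelˡ-≤ x (begin
  x * (2 * x ^ x)      ≡⟨ e x (x ^ x) ⟩
  x ^ x * (x + x)      ≤⟨ bernoulli x x ⟩
  x * suc x ^ x        ∎)
  where
  open ≤-Reasoning
  e : ∀ x y → x * (2 * y) ≡ y * (x + x)
  e = solve-∀

-- With m = 2Xl + 1 the number of pairs is exactly Xlm, so (1 + 1/X) to that power is at least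
-- 2^(lm), which exceeds the number n^m of tuples.
tuple-count : ∀ {n X l} .{{_ : NonZero X}} → n < 2 ^ l → let m = suc (2 * X * l) in
  n ^ m * X ^ choose₂ m < suc X ^ choose₂ m
tuple-count {n} {X} {l} n<2^l = begin-strict
  n ^ m * X ^ c                  <⟨ *-monoˡ-< (X ^ c) {{m^n≢0 X c}} (^-monoˡ-< m n<2^l) ⟩
  (2 ^ l) ^ m * X ^ c            ≡⟨ cong₂ _*_ (^-*-assoc 2 l m) (trans (cong (X ^_) c≡) (sym (^-*-assoc X X (l * m)))) ⟩
  2 ^ (l * m) * (X ^ X) ^ (l * m) ≡⟨ sym (^-distribʳ-* (l * m) 2 (X ^ X)) ⟩
  (2 * X ^ X) ^ (l * m)          ≤⟨ ^-monoˡ-≤ (l * m) (2x^x≤ X) ⟩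
  (suc X ^ X) ^ (l * m)          ≡⟨ trans (^-*-assoc (suc X) X (l * m)) (cong (suc X ^_) (sym c≡)) ⟩
  suc X ^ c                      ∎
  where
  open ≤-Reasoning
  m = suc (2 * X * l)
  c = choose₂ m
  e : ∀ X l m → suc (2 * X * l) * m ≡ 2 * (X * (l * m)) + m
  e = solve-∀
  c≡ : c ≡ X * (l * m)
  c≡ = *-cancelˡ-≡ c (X * (l * m)) 2 (+-cancelʳ-≡ m (2 * c) (2 * (X * (l * m)))
    (trans (choose₂-*2 m) (e X l m)))

-- The hypothesis forces 4n ≤ M², for otherwise M⁴ ≤ 16n² ≤ 16n³. Then 2nM² ≤ M⁴/2 and 2n³ < M⁴/8.
link-weight : ∀ n M → 16 * (n * n * n) < M ^ 4 → 2 * (n * M ^ 2 + n * n * n) ≤ M ^ 4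
link-weight zero M _ = z≤n
link-weight n@(suc _) M lt = *-cancelˡ-≤ 4 (begin
  4 * (2 * (n * M ^ 2 + n * n * n))              ≡⟨ e₁ n (M ^ 2) ⟩
  2 * (4 * n * M ^ 2) + 8 * (n * n * n)          ≤⟨ +-mono-≤ (*-monoʳ-≤ 2 (*-monoˡ-≤ (M ^ 2) 4n≤)) (*-monoˡ-≤ (n * n * n) (m≤m+n 8 8)) ⟩
  2 * (M ^ 2 * M ^ 2) + 16 * (n * n * n)         ≤⟨ +-mono-≤ (≤-reflexive (cong (2 *_) (sym (^-distribˡ-+-* M 2 2)))) (<⇒≤ lt) ⟩
  2 * M ^ 4 + M ^ 4                              ≤⟨ m≤m+n _ (M ^ 4) ⟩
  2 * M ^ 4 + M ^ 4 + M ^ 4                      ≡⟨ e₂ (M ^ 4) ⟩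
  4 * M ^ 4                                      ∎)
  where
  open ≤-Reasoning
  e₁ : ∀ n x → 4 * (2 * (n * x + n * n * n)) ≡ 2 * (4 * n * x) + 8 * (n * n * n)
  e₁ = solve-∀
  e₂ : ∀ x → 2 * x + x + x ≡ 4 * x
  e₂ = solve-∀
  e₃ : ∀ n → 4 * n * (4 * n) ≡ 16 * (n * n)
  e₃ = solve-∀
  4n≤ : 4 * n ≤ M ^ 2
  4n≤ with 4 * n ≤? M ^ 2
  ... | yes p = p
  ... | no ¬p = ⊥-elim (<-irrefl refl (begin-strict
    M ^ 4                ≡⟨ ^-distribˡ-+-* M 2 2 ⟩
    M ^ 2 * M ^ 2        ≤⟨ *-mono-≤ (<⇒≤ (≰⇒> ¬p)) (<⇒≤ (≰⇒> ¬p)) ⟩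
    4 * n * (4 * n)      ≡⟨ e₃ n ⟩
    16 * (n * n)         ≤⟨ *-monoʳ-≤ 16 (m≤m*n (n * n) n) ⟩
    16 * (n * n * n)     <⟨ lt ⟩
    M ^ 4                ∎))

-- a, b and c are variables because products with large literals would be unfolded in unary.
O-arithmetic : ∀ a b c {n p q K h} → b ^ 4 * a ≡ c ^ 4 → K ^ 4 ≤ a * (n * n * n) → h * q ≤ b * K * p →
  (1 * h) ^ 4 * q ^ 4 ≤ c ^ 4 * (n ^ 3 * p ^ 4)
O-arithmetic a b c {n} {p} {q} {K} {h} b⁴a≡c⁴ K⁴≤ hq≤ = begin
  (1 * h) ^ 4 * q ^ 4                   ≡⟨ e₁ ⟩
  (h * q) ^ 4                           ≤⟨ ^-monoˡ-≤ 4 hq≤ ⟩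
  (b * K * p) ^ 4                       ≡⟨ e₂ ⟩
  b ^ 4 * p ^ 4 * K ^ 4                 ≤⟨ *-monoʳ-≤ (b ^ 4 * p ^ 4) K⁴≤ ⟩
  b ^ 4 * p ^ 4 * (a * (n * n * n))     ≡⟨ e₃ a (b ^ 4) n (p ^ 4) ⟩
  b ^ 4 * a * (n ^ 3 * p ^ 4)           ≡⟨ cong (_* (n ^ 3 * p ^ 4)) b⁴a≡c⁴ ⟩
  c ^ 4 * (n ^ 3 * p ^ 4)               ∎
  where
  open ≤-Reasoning
  e₁ : (1 * h) ^ 4 * q ^ 4 ≡ (h * q) ^ 4
  e₁ = trans (cong (λ x → x ^ 4 * q ^ 4) (*-identityˡ h)) (sym (^-distribʳ-* 4 h q))
  shuffle : ∀ x y z → x * y * z ≡ x * z * y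
  shuffle = solve-∀
  e₂ : (b * K * p) ^ 4 ≡ b ^ 4 * p ^ 4 * K ^ 4
  e₂ = trans (^-distribʳ-* 4 (b * K) p) (trans (cong (_* p ^ 4) (^-distribʳ-* 4 b K)) (shuffle (b ^ 4) (K ^ 4) (p ^ 4)))
  e₃ : ∀ a b n p → b * p * (a * (n * n * n)) ≡ b * a * ((n * (n * (n * 1))) * p)
  e₃ = solve-∀

-- Applied to 16n³: the root K = `suc k` bounds the result from above, while K + 1 serves as `M`,
-- where a strict inequality is required. That K is positive gives K + 1 ≤ 2K.
fourth-root : ∀ N → NonZero N → ∃[ k ] suc k ^ 4 ≤ N × N < suc (suc k) ^ 4
fourth-root N N≢0 with bracket (_^ 4) N (suc N) z≤n (m≤m*n (suc N) (suc N ^ 3) {{m^n≢0 (suc N) 3}})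
... | zero  , _ , N<1 = ⊥-elim (≢-nonZero⁻¹ N {{N≢0}} (n≤0⇒n≡0 (s≤s⁻¹ N<1)))
... | suc k , lo , hi = k , lo , hi

h₂≤-random : ∀ n M l .{{_ : NonZero M}} → 16 * (n * n * n) < M ^ 4 → n < 2 ^ l →
  let m = suc (2 * (2 * M) * l) in h₂ n ℋ (allBlue n) ≤ m + (m + m)
h₂≤-random n M@(suc _) l lt n<2^l =
  let G , α = ShortOddCycles.random-graph M (suc (2 * (2 * M) * l)) (link-weight n M lt) (tuple-count {n} {2 * M} {l} n<2^l)
  in h₂≤ G α

-- With M = K + 1 and l′ = l + 2, 3m = 12Ml′ + 3 ≤ 15Ml′ ≤ 30Kl′, and l′ ≤ 2(l + 1) doubles the
-- constant to 60.
hq-bound : ∀ k l {h p q} → let K = suc k ; m = suc (2 * (2 * suc K) * suc (suc l)) in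
  h ≤ m + (m + m) → suc l * q ≤ p → h * q ≤ 60 * K * p
hq-bound k l {h} {p} {q} h≤ lq≤p = begin
  h * q                                             ≤⟨ *-monoˡ-≤ q h≤ ⟩
  (m + (m + m)) * q                                 ≡⟨ cong (_* q) (e₁ (suc K) l′) ⟩
  (12 * (suc K * l′) + 3 * 1) * q                   ≤⟨ *-monoˡ-≤ q (+-mono-≤ (*-monoʳ-≤ 12 Ml≤) (*-monoʳ-≤ 3 (≤-trans (s≤s z≤n) Ml≤))) ⟩
  (12 * (2 * K * l′) + 3 * (2 * K * l′)) * q        ≡⟨ e₂ K l′ q ⟩
  30 * K * (l′ * q)                                 ≤⟨ *-monoʳ-≤ (30 * K) l′q≤ ⟩
  30 * K * (2 * p)                                  ≡⟨ e₃ K p ⟩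
  60 * K * p                                        ∎
  where
  open ≤-Reasoning
  K = suc k
  l′ = suc (suc l)
  m = suc (2 * (2 * suc K) * l′)
  e₁ : ∀ M l → suc (2 * (2 * M) * l) + (suc (2 * (2 * M) * l) + suc (2 * (2 * M) * l)) ≡ 12 * (M * l) + 3 * 1
  e₁ = solve-∀
  e₂ : ∀ K l q → (12 * (2 * K * l) + 3 * (2 * K * l)) * q ≡ 30 * K * (l * q)
  e₂ = solve-∀
  e₃ : ∀ K p → 30 * K * (2 * p) ≡ 60 * K * p
  e₃ = solve-∀
  Ml≤ : suc K * l′ ≤ 2 * K * l′
  Ml≤ = *-monoˡ-≤ l′ (≤-trans (+-monoˡ-≤ K (s≤s z≤n)) (≤-reflexive (cong (K +_) (sym (+-identityʳ K)))))
  l′q≤ : l′ * q ≤ 2 * p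
  l′q≤ = begin
    q + suc l * q        ≤⟨ +-monoˡ-≤ (suc l * q) (m≤m+n q (l * q)) ⟩
    suc l * q + suc l * q ≤⟨ +-mono-≤ lq≤p lq≤p ⟩
    p + p                ≡⟨ cong (p +_) (sym (+-identityʳ p)) ⟩
    2 * p                ∎

O-bound : ∀ c → 60 ^ 4 * 16 ≡ c ^ 4 → ∀ n → n ≥ 2 → h₂ n ℋ (allBlue n) ≤ c / 1 · [n^ 3 ·log^ 4 ]^1/ 4 at n
O-bound c c⁴ n n≥2 p q _ n^q≤2^p with fourth-root (16 * (n * n * n)) (16n³≢0 n≥2) | bracket (2 ^_) n n (<⇒≤ n≥2) (m<2^m n)
  where
  16n³≢0 : ∀ {n} → n ≥ 2 → NonZero (16 * (n * n * n))
  16n³≢0 (s≤s (s≤s _)) = _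
... | _ | zero , _ , n<2 = ⊥-elim (<⇒≱ n<2 n≥2)
... | k , K⁴≤ , <M⁴ | suc l , 2^l≤n , n<2^l =
  O-arithmetic 16 60 c {n} {p} {q} {suc k} {h₂ n ℋ (allBlue n)} c⁴ K⁴≤
    (hq-bound k l (h₂≤-random n (suc (suc k)) (suc (suc l)) <M⁴ n<2^l)
      (2^-cancel-≤ (≤-trans (≤-reflexive (sym (^-*-assoc 2 (suc l) q))) (≤-trans (^-monoˡ-≤ q 2^l≤n) n^q≤2^p))))

upper-bound : (λ n → h₂ n ℋ (allBlue n)) isO ([n^ 3 ·log^ 4 ]^1/ 4)
-- 120 is 60 times the fourth root of 16.
upper-bound = 120 , 1 , 2 , s≤s z≤n , s≤s z≤n , O-bound 120 refl

lemma3p18 : ((λ n → h₂ n ℋ (allBlue n)) isΩ ([n^ 2 ·log^ 1 ]^1/ 3)) ×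
    ((λ n → h₂ n ℋ (allBlue n)) isO ([n^ 3 ·log^ 4 ]^1/ 4))
lemma3p18 = lower-bound , upper-bound
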